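{- Let $q$ be a prime power and $n$ a positive integer. Let $g, h\in \mathbb{F}_q[x]$, where $g(x)$ is a monic divisor of $x^n-1$, and let $f, k\in\mathbb{F}_{q^n}[x]$ be such that $k(L_g(\mathbb{F}_{q^n}))\subseteq \mathbb{F}_q^*$. Let $P(x)=f(L_g(x))+k(L_g(x))\cdot L_h(x)$. Then $P$ is a permutation polynomial of $\mathbb{F}_{q^n}$ if and only if both of the following hold: (i) $\gcd(g, h)=1$; (ii) the polynomial $Q(x)=L_g(f(x))+k(x)\cdot L_h(x)$ induces a permutation of the set $L_g(\mathbb{F}_{q^n})=\{L_g(c):c\in\mathbb{F}_{q^n}\}$.
   Context: For a polynomial $u(x)=\sum_{i=0}^m a_i x^i\in\mathbb{F}_q[x]$, its linearized $q$-associate is $L_u(x)=\sum_{i=0}^m a_i x^{q^i}$. A polynomial $P\in\mathbb{F}_{q^n}[x]$ is a permutation polynomial of $\mathbb{F}_{q^n}$ if $c\mapsto P(c)$ is a bijection of $\mathbb{F}_{q^n}$. -}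

module Defs where

open import Algebra.Bundles using (CommutativeRing)
open import Algebra.Bundles.Raw using (RawRing)
open import Data.Fin.Base using (Fin; toℕ)
open import Data.List.Base using (List; []; _∷_; length; lookup; map)
open import Data.Nat.Base as ℕ using (ℕ; zero; suc; NonZero)
open import Data.Nat.Primality using (Prime)
open import Data.Product.Base using (Σ; Σ-syntax; ∃; ∃-syntax; _×_; _,_; proj₁)
open import Function.Bundles using (Inverse)
open import Function.Definitions using (Bijective)
open import Level using (Level; _⊔_) renaming (suc to lsuc)
open import Relation.Binary.Core using (Rel)
open import Relation.Binary.PropositionalEquality.Core using (_≡_)
import Relation.Binary.PropositionalEquality.Properties as ≡
open import Relation.Unary using (Pred; _∈_)

import Algebra.Definitions as Definitions
import Algebra.Definitions.RawSemiring as RawSemiringDefinitions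

IsPrimePower : ℕ → Set
IsPrimePower q = ∃[ p ] ∃[ e ] Prime p × NonZero e × q ≡ p ℕ.^ e

-- A field with exactly q elements, up to its setoid equality.
record FiniteField (c ℓ : Level) (q : ℕ) : Set (lsuc (c ⊔ ℓ)) where
  field
    commutativeRing : CommutativeRing c ℓ

  open CommutativeRing commutativeRing public

  field
    1≉0        : 1# ≉ 0#
    invertible : ∀ x → x ≉ 0# → Definitions.Invertible _≈_ 1# _*_ x
    finite     : Inverse setoid (≡.setoid (Fin q))

-- Univariate polynomials as coefficient lists, constant term first.
-- Trailing zeros are allowed: equality compares coefficients, those beyond
-- the end of the list being 0.
module Polynomial {c ℓ} (R : RawRing c ℓ) where
  private module R = RawRing R

  Poly : Set c
  Poly = List R.Carrier

  coeff : Poly → ℕ → R.Carrier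
  coeff []      _       = R.0#
  coeff (a ∷ u) zero    = a
  coeff (a ∷ u) (suc i) = coeff u i

  infix 4 _≈ᴾ_
  _≈ᴾ_ : Rel Poly ℓ
  u ≈ᴾ v = ∀ i → coeff u i R.≈ coeff v i

  C : R.Carrier → Poly
  C a = a ∷ []

  X : Poly
  X = R.0# ∷ R.1# ∷ []

  addᴾ : Poly → Poly → Poly
  addᴾ []      v       = v
  addᴾ (a ∷ u) []      = a ∷ u
  addᴾ (a ∷ u) (b ∷ v) = a R.+ b ∷ addᴾ u v

  mulᴾ : Poly → Poly → Poly
  mulᴾ []      v = []
  mulᴾ (a ∷ u) v = addᴾ (map (a R.*_) v) (R.0# ∷ mulᴾ u v)

  polyRawRing : RawRing c ℓ
  polyRawRing = record
    { Carrier = Poly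
    ; _≈_     = _≈ᴾ_
    ; _+_     = addᴾ
    ; _*_     = mulᴾ
    ; -_      = map R.-_
    ; 0#      = []
    ; 1#      = C R.1#
    }

  open RawRing polyRawRing public using (_+_; _*_; -_; 0#; 1#)
  open RawSemiringDefinitions (RawRing.rawSemiring polyRawRing) public
    using (_^_; _∣_; sum)

  infixl 9 _∘ᴾ_
  _∘ᴾ_ : Poly → Poly → Poly
  []      ∘ᴾ v = 0#
  (a ∷ u) ∘ᴾ v = C a + v * (u ∘ᴾ v)

  eval : Poly → R.Carrier → R.Carrier
  eval []      x = R.0#
  eval (a ∷ u) x = a R.+ x R.* eval u x

  Monic : Poly → Set ℓ
  Monic u = ∃[ m ] coeff u m R.≈ R.1# × (∀ i → m ℕ.< i → coeff u i R.≈ R.0#)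

  record IsGCD (u v d : Poly) : Set (c ⊔ ℓ) where
    field
      monic    : Monic d
      ∣ˡ       : d ∣ u
      ∣ʳ       : d ∣ v
      greatest : ∀ {w} → w ∣ u → w ∣ v → w ∣ d

  -- The linearized q-associate: Σ aᵢ xⁱ is sent to Σ aᵢ x^(qⁱ).
  associate : ℕ → Poly → Poly
  associate q u = sum λ (i : Fin (length u)) → C (lookup u i) * X ^ (q ℕ.^ toℕ i)

  IsPermutationPolynomial : Poly → Set (c ⊔ ℓ)
  IsPermutationPolynomial u = Bijective R._≈_ R._≈_ (eval u)

  valueSet : Poly → Pred R.Carrier (c ⊔ ℓ)
  valueSet u y = ∃[ x ] eval u x R.≈ y

  -- u maps the subset S to itself, and the restricted map S → S is bijective;
  -- elements of S are compared as elements of R, ignoring membership proofs.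
  InducesPermutationOf : ∀ {s} → Pred R.Carrier s → Poly → Set (c ⊔ ℓ ⊔ s)
  InducesPermutationOf S u =
    Σ[ closed ∈ (∀ {x} → x ∈ S → eval u x ∈ S) ]
      Bijective _≈ₛ_ _≈ₛ_ λ (x , x∈S) → eval u x , closed x∈S
    where
    _≈ₛ_ : Rel (∃ S) ℓ
    x ≈ₛ y = proj₁ x R.≈ proj₁ y

{-# OPTIONS --safe #-}
-- The polynomials P and Q are intertwined: L_g ∘ P = Q ∘ L_g on K = 𝔽qⁿ, because L_g is 𝔽q-linear and
-- k takes values in 𝔽q on L_g(K). On a fibre of L_g, P is a translate of a nonzero multiple of L_h.
-- Hence P is a permutation iff Q permutes L_g(K) and ker L_g ∩ ker L_h = 0.
--
-- Composition of the L_u is multiplication of the u. So if g and h are coprime, the Euclidean algorithm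
-- carries a common zero of L_g and L_h down to a zero of L_1 = id. Conversely, let the kernels meet
-- in 0 and let w divide both g and h. Then L_w is injective, hence onto, on K, so the cofactor v in
-- xⁿ − 1 = v w has L_v = 0 on K; reducing v modulo xⁿ − 1 leaves a remainder r with L_r of degree below
-- qⁿ and qⁿ roots, so xⁿ − 1 divides v and w is a unit.
module Submission where

open import Defs
open import Algebra.Bundles using (CommutativeMonoid; CommutativeRing)
open import Algebra.Definitions.RawMagma using (_,_)
open import Algebra.Morphism.Construct.Identity using (isRingHomomorphism)
open import Algebra.Morphism.Structures using (module RingMorphisms)
open import Data.Fin.Base using (Fin; zero; suc; toℕ; inject₁; fromℕ; punchIn)
open import Data.Fin.Permutation using (Permutation′; permutation; _⟨$⟩ʳ_)
open import Data.List.Base using ([]; _∷_; length; lookup; map)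
open import Data.List.Properties using (map-id)
open import Data.Nat.Base as ℕ using (ℕ; zero; suc; z≤n; s≤s; z<s; s<s; _!; NonZero)
open import Data.Nat.Combinatorics using (nCn≡1; nCk≡n!/k![n-k]!; k![n∸k]!∣n!) renaming (_C_ to _choose_)
open import Data.Nat.DivMod using (m/n*n≡m)
open import Data.Nat.Primality using (Prime; euclidsLemma; prime⇒nonTrivial; prime⇒nonZero; ¬prime[0]; ¬prime[1])
open import Data.Product.Base using (∃; ∃-syntax; _×_; _,_; proj₁; proj₂)
open import Data.Sum.Base using (_⊎_; inj₁; inj₂)
open import Data.Vec.Functional using (init; last; removeAt; tail)
open import Function.Base using (_∘_; id)
open import Function.Bundles using (Inverse; _⇔_; mk⇔)
open import Relation.Binary.Bundles using (Setoid)
open import Relation.Binary.Definitions using () renaming (Decidable to Decidable₂)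
open import Relation.Binary.PropositionalEquality.Core as ≡ using (_≡_; _≢_)
open import Relation.Nullary.Decidable using (Dec; yes; no; map′)
open import Relation.Nullary.Negation using (¬_; contradiction)
open import Relation.Unary using (Decidable; Pred; _∈_)
import Algebra.Properties.CommutativeMonoid.Sum as MonoidSum
import Algebra.Properties.CommutativeSemigroup as CommutativeSemigroupProperties
import Algebra.Properties.CommutativeSemiring.Binomial as Binomial
import Algebra.Properties.CommutativeSemiring.Exp as Exp
import Algebra.Properties.Ring as RingProperties
import Algebra.Properties.Semiring.Mult as Mult
import Algebra.Properties.Semiring.Sum as Sum
import Algebra.Solver.Ring.NaturalCoefficients.Default as RingSolver
import Data.Fin.Properties as Fin
import Data.Nat.Divisibility as ℕ
import Data.Nat.Properties as ℕ
import Relation.Binary.Reasoning.Setoid as SetoidReasoning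

-- From P to Q, only surjectivity passes through the intertwining relation. Injectivity of Q on
-- L_g(K) comes from finiteness, and since L_g(K) is known only as a decidable subset of K, Q is
-- compared with a self-map of all of K.
--
-- Coefficient lists with trailing zeros have no evident degree or leading coefficient. Degree
-- arguments therefore use upper bounds, division takes an inverse of a designated coefficient as
-- data, and xⁿ - 1 is cancelled from the bottom: its constant term -1 is a unit because n ≥ 1.
--
-- Finite fields enter through two facts. In a field with N elements x^N = x; for N = q this fixes
-- the coefficients of L_u under the q-th power, and for N = qⁿ it makes the associate of xⁿ - 1
-- vanish on K. Moreover K has characteristic p, so that the q-th power is additive. The root count
-- needs q > 1, which keeps the exponents q^i distinct.

-- Binomial coefficients modulo a prime, and the pigeonhole principle

prime∤! : ∀ {p} → Prime p → ∀ m → m ℕ.< p → ¬ p ℕ.∣ m !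
prime∤! pr zero    m<p p∣1 = ℕ.<⇒≱ (ℕ.nonTrivial⇒n>1 _ {{prime⇒nonTrivial pr}}) (ℕ.∣⇒≤ p∣1)
prime∤! pr (suc m) m<p p∣m! with euclidsLemma (suc m) (m !) pr p∣m!
... | inj₁ p∣1+m = ℕ.<⇒≱ m<p (ℕ.∣⇒≤ p∣1+m)
... | inj₂ p∣m!′ = prime∤! pr m (ℕ.<-trans (ℕ.n<1+n m) m<p) p∣m!′

-- The prime p divides p! = C(p,k) · k! · (p-k)!, but neither factorial on the right, whose factors
-- are all below p.
prime∣C : ∀ {p k} → Prime p → 0 ℕ.< k → k ℕ.< p → p ℕ.∣ (p choose k)
prime∣C {p@(suc p-1)} {k@(suc k-1)} pr 0<k k<p
  with euclidsLemma (p choose k) (k ! ℕ.* (p ℕ.∸ k) !) pr p∣C*k![p-k]!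
  where
  p∣C*k![p-k]! : p ℕ.∣ (p choose k) ℕ.* (k ! ℕ.* (p ℕ.∸ k) !)
  p∣C*k![p-k]! = ≡.subst (p ℕ.∣_)
    (≡.sym (≡.trans (≡.cong (ℕ._* (k ! ℕ.* (p ℕ.∸ k) !)) (nCk≡n!/k![n-k]! (ℕ.<⇒≤ k<p)))
                    (m/n*n≡m {{k ℕ.!* (p ℕ.∸ k) !≢0}} (k![n∸k]!∣n! (ℕ.<⇒≤ k<p)))))
    (ℕ.m∣m*n {p} (p-1 !))
... | inj₁ p∣C = p∣C
... | inj₂ p∣k![p-k]! with euclidsLemma (k !) ((p ℕ.∸ k) !) pr p∣k![p-k]!
...   | inj₁ p∣k!     = contradiction p∣k! (prime∤! pr k k<p)
...   | inj₂ p∣[p-k]! =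
  -- Since k ≥ 1, p - k ≤ p - 1 < p.
  contradiction p∣[p-k]! (prime∤! pr (p ℕ.∸ k) (s≤s (ℕ.m∸n≤m p-1 k-1)))

-- A missed value can be punched out of the codomain, leaving an injection of `Fin (suc n)` into
-- `Fin n`.
Fin-injective⇒surjective : ∀ {n} (f : Fin n → Fin n) → (∀ {i j} → f i ≡ f j → i ≡ j) →
                           ∀ j → ∃[ i ] f i ≡ j
Fin-injective⇒surjective {suc n} f f-inj j with Fin.any? (λ i → f i Fin.≟ j)
... | yes hit = hit
... | no miss = contradiction (Fin.injective⇒≤ λ {i} {i′} eq →
                  f-inj (Fin.punchOut-injective (avoid i) (avoid i′) eq)) ℕ.1+n≰n
  where
  avoid : ∀ i → j ≢ f i
  avoid i eq = miss (i , ≡.sym eq)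

-- Additivity of the p-th power in characteristic p

module _ {c ℓ} (R : CommutativeRing c ℓ) where
  open CommutativeRing R hiding (zero)
  open Exp commutativeSemiring using (_^_; ^-assocʳ; ^-congˡ)
  open Mult semiring using (×-congʳ; ×-congˡ; ×1-homo-*; ×-assoc-*) renaming (_×_ to _×ᴿ_)
  open MonoidSum +-commutativeMonoid using (sum; sum-cong-≋; sum-init-last; sum-replicate-zero)
  open SetoidReasoning setoid

  p∣n⇒n×x≈0 : ∀ {p n} → p ×ᴿ 1# ≈ 0# → p ℕ.∣ n → ∀ x → n ×ᴿ x ≈ 0#
  p∣n⇒n×x≈0 {p} {n} p×1≈0 (ℕ.divides m n≡m*p) x = begin
    n ×ᴿ x                        ≈⟨ ×-congʳ n (*-identityˡ x) ⟨
    n ×ᴿ (1# * x)                 ≈⟨ ×-assoc-* n 1# x ⟨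
    (n ×ᴿ 1#) * x                 ≈⟨ *-congʳ (×-congˡ n≡m*p) ⟩
    ((m ℕ.* p) ×ᴿ 1#) * x         ≈⟨ *-congʳ (×1-homo-* m p) ⟩
    ((m ×ᴿ 1#) * (p ×ᴿ 1#)) * x   ≈⟨ *-congʳ (*-congˡ p×1≈0) ⟩
    ((m ×ᴿ 1#) * 0#) * x          ≈⟨ *-congʳ (zeroʳ _) ⟩
    0# * x                        ≈⟨ zeroˡ x ⟩
    0#                            ∎

  -- In the binomial theorem every term but the two extreme ones has a coefficient divisible by p.
  ^prime-homo-+ : ∀ {p} → Prime p → p ×ᴿ 1# ≈ 0# → ∀ x y → (x + y) ^ p ≈ x ^ p + y ^ p
  ^prime-homo-+ {0} pr = contradiction pr ¬prime[0]
  ^prime-homo-+ {1} pr = contradiction pr ¬prime[1]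
  ^prime-homo-+ {p@(suc p-1@(suc p-2))} pr p×1≈0 x y = begin
    (x + y) ^ p                                         ≈⟨ theorem p x y ⟩
    sum term                                            ≈⟨ +-congˡ (sum-init-last (tail term)) ⟩
    term zero + (sum (init (tail term)) + last (tail term)) ≈⟨ +-cong first≈ (+-cong middle≈ last≈) ⟩
    y ^ p + (0# + x ^ p)                                ≈⟨ +-congˡ (+-identityˡ _) ⟩
    y ^ p + x ^ p                                       ≈⟨ +-comm _ _ ⟩
    x ^ p + y ^ p                                       ∎
    where
    open Binomial commutativeSemiring using (theorem; binomialTerm; binomial)
    term : Fin (suc p) → Carrier
    term = binomialTerm x y p
    first≈ : term zero ≈ y ^ p
    first≈ = trans (+-identityʳ _) (*-identityˡ _)
    middle≈ : sum (init (tail term)) ≈ 0#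
    middle≈ = trans
      (sum-cong-≋ λ i → p∣n⇒n×x≈0 p×1≈0
        (prime∣C pr z<s (s<s (≡.subst (ℕ._< p-1) (≡.sym (Fin.toℕ-inject₁ i)) (Fin.toℕ<n i))))
        (binomial x y p (suc (inject₁ i))))
      (sum-replicate-zero p-1)
    last≈ : last (tail term) ≈ x ^ p
    last≈ = begin
      (p choose suc (toℕ (fromℕ p-1))) ×ᴿ (x ^ suc (toℕ (fromℕ p-1)) * y ^ (p-1 ℕ.∸ toℕ (fromℕ p-1)))
        ≡⟨ ≡.cong (λ k → (p choose suc k) ×ᴿ (x ^ suc k * y ^ (p-1 ℕ.∸ k))) (Fin.toℕ-fromℕ p-1) ⟩
      (p choose p) ×ᴿ (x ^ p * y ^ (p-1 ℕ.∸ p-1))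
        ≡⟨ ≡.cong₂ (λ m k → m ×ᴿ (x ^ p * y ^ k)) (nCn≡1 p) (ℕ.n∸n≡0 p-1) ⟩
      1 ×ᴿ (x ^ p * 1#)
        ≈⟨ +-identityʳ _ ⟩
      x ^ p * 1#
        ≈⟨ *-identityʳ _ ⟩
      x ^ p
        ∎

  ^prime^-homo-+ : ∀ {p} → Prime p → p ×ᴿ 1# ≈ 0# → ∀ e x y →
                       (x + y) ^ (p ℕ.^ e) ≈ x ^ (p ℕ.^ e) + y ^ (p ℕ.^ e)
  ^prime^-homo-+ pr p×1≈0 zero    x y =
    trans (*-identityʳ _) (sym (+-cong (*-identityʳ x) (*-identityʳ y)))
  ^prime^-homo-+ {p} pr p×1≈0 (suc e) x y = begin
    (x + y) ^ (p ℕ.* p ℕ.^ e)                         ≈⟨ ^-assocʳ (x + y) p (p ℕ.^ e) ⟨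
    ((x + y) ^ p) ^ (p ℕ.^ e)                         ≈⟨ ^-congˡ (p ℕ.^ e) (^prime-homo-+ pr p×1≈0 x y) ⟩
    (x ^ p + y ^ p) ^ (p ℕ.^ e)                       ≈⟨ ^prime^-homo-+ pr p×1≈0 e (x ^ p) (y ^ p) ⟩
    (x ^ p) ^ (p ℕ.^ e) + (y ^ p) ^ (p ℕ.^ e)         ≈⟨ +-cong (^-assocʳ x p (p ℕ.^ e)) (^-assocʳ y p (p ℕ.^ e)) ⟩
    x ^ (p ℕ.* p ℕ.^ e) + y ^ (p ℕ.* p ℕ.^ e)         ∎

-- Finite fields: counting, characteristic, x^N = x

module FiniteFieldProperties {c ℓ N} (𝔽 : FiniteField c ℓ N) where
  open FiniteField 𝔽 hiding (zero)
  open RingProperties ring using (+-identityˡ-unique)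
  open Exp commutativeSemiring using (_^_; ^-congˡ)
  open Mult semiring using (×1-homo-*; ×-congˡ) renaming (_×_ to _×ᴿ_)
  private
    module + = MonoidSum +-commutativeMonoid
    module * = MonoidSum *-commutativeMonoid
  open SetoidReasoning setoid

  index : Carrier → Fin N
  index = Inverse.to finite

  element : Fin N → Carrier
  element = Inverse.from finite

  element-index : ∀ x → element (index x) ≈ x
  element-index = Inverse.strictlyInverseʳ finite

  index-element : ∀ i → index (element i) ≡ i
  index-element = Inverse.strictlyInverseˡ finite

  index-injective : ∀ {x y} → index x ≡ index y → x ≈ y
  index-injective {x} {y} eq =
    trans (sym (element-index x)) (trans (reflexive (≡.cong element eq)) (element-index y))

  element-injective : ∀ {i j} → element i ≈ element j → i ≡ j
  element-injective {i} {j} eq =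
    ≡.trans (≡.sym (index-element i)) (≡.trans (Inverse.to-cong finite eq) (index-element j))

  infix 4 _≟_
  _≟_ : Decidable₂ _≈_
  x ≟ y = map′ index-injective (Inverse.to-cong finite) (index x Fin.≟ index y)

  any? : ∀ {p} {P : Pred Carrier p} → (∀ {x y} → x ≈ y → P x → P y) → Decidable P → Dec (∃ P)
  any? resp P? = map′ (λ (i , p) → element i , p)
                      (λ (x , p) → index x , resp (sym (element-index x)) p)
                      (Fin.any? (P? ∘ element))

  injective⇒surjective : ∀ (f : Carrier → Carrier) → (∀ {x y} → f x ≈ f y → x ≈ y) →
                         ∀ y → ∃[ x ] f x ≈ y
  injective⇒surjective f f-inj y =
    let i , eq = Fin-injective⇒surjective (index ∘ f ∘ element)
                   (element-injective ∘ f-inj ∘ index-injective) (index y)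
    in element i , index-injective eq

  -- A right inverse s of f is injective, hence onto, so f is a two-sided inverse of s.
  surjective⇒injective : ∀ (f : Carrier → Carrier) → (∀ {x y} → x ≈ y → f x ≈ f y) →
                         (∀ y → ∃[ x ] f x ≈ y) → ∀ {x y} → f x ≈ f y → x ≈ y
  surjective⇒injective f f-cong f-sur {x} {y} fx≈fy = begin
    x                 ≈⟨ sec-retract x ⟨
    s (index (f x))   ≡⟨ ≡.cong s (Inverse.to-cong finite fx≈fy) ⟩
    s (index (f y))   ≈⟨ sec-retract y ⟩
    y                 ∎
    where
    s : Fin N → Carrier
    s i = proj₁ (f-sur (element i))
    f∘s : ∀ i → f (s i) ≈ element i
    f∘s i = proj₂ (f-sur (element i))
    onto : ∀ j → ∃[ i ] index (s i) ≡ j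
    onto = Fin-injective⇒surjective (index ∘ s) λ {i} {j} eq → element-injective
      (trans (sym (f∘s i)) (trans (f-cong (index-injective eq)) (f∘s j)))
    sec-retract : ∀ x → s (index (f x)) ≈ x
    sec-retract x =
      let i , eq = onto (index x)
          si≈x = index-injective eq
          i≡ = ≡.trans (≡.sym (index-element i))
                 (Inverse.to-cong finite (trans (sym (f∘s i)) (f-cong si≈x)))
      in trans (reflexive (≡.cong s (≡.sym i≡))) si≈x

  -- Extending f by the identity outside S reduces the claim to S = everything.
  surjective⇒injective-on : ∀ {s} {S : Pred Carrier s} → Decidable S → (∀ {x y} → x ≈ y → S x → S y) →
    ∀ (f : Carrier → Carrier) → (∀ {x y} → x ≈ y → f x ≈ f y) →
    (∀ {y} → S y → ∃[ x ] S x × f x ≈ y) →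
    ∀ {x y} → S x → S y → f x ≈ f y → x ≈ y
  surjective⇒injective-on {S = S} S? S-resp f f-cong f-sur {x} {y} x∈S y∈S fx≈fy =
    surjective⇒injective f̂ (λ x≈y → f̂-cong x≈y (S? _) (S? _)) f̂-sur
      (trans (f̂-inside x∈S (S? x)) (trans fx≈fy (sym (f̂-inside y∈S (S? y)))))
    where
    extend : ∀ x → Dec (S x) → Carrier
    extend x (yes _) = f x
    extend x (no  _) = x

    f̂ : Carrier → Carrier
    f̂ x = extend x (S? x)

    f̂-inside : ∀ {x} → S x → (d : Dec (S x)) → extend x d ≈ f x
    f̂-inside x∈S (yes _)   = refl
    f̂-inside x∈S (no  x∉S) = contradiction x∈S x∉S

    f̂-cong : ∀ {x y} → x ≈ y → (d : Dec (S x)) (e : Dec (S y)) → extend x d ≈ extend y e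
    f̂-cong x≈y (yes _)   (yes _)   = f-cong x≈y
    f̂-cong x≈y (yes x∈S) (no  y∉S) = contradiction (S-resp x≈y x∈S) y∉S
    f̂-cong x≈y (no  x∉S) (yes y∈S) = contradiction (S-resp (sym x≈y) y∈S) x∉S
    f̂-cong x≈y (no  _)   (no  _)   = x≈y

    f̂-outside : ∀ {y} → ¬ S y → (d : Dec (S y)) → extend y d ≈ y
    f̂-outside y∉S (yes y∈S) = contradiction y∈S y∉S
    f̂-outside y∉S (no  _)   = refl

    f̂-sur : ∀ y → ∃[ x ] f̂ x ≈ y
    f̂-sur y with S? y
    ... | yes y∈S = let x , x∈S , fx≈y = f-sur y∈S in x , trans (f̂-inside x∈S (S? x)) fx≈y
    ... | no  y∉S = y , f̂-outside y∉S (S? y)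

  *-cancelˡ-nonZero : ∀ {x y z} → x ≉ 0# → x * y ≈ x * z → y ≈ z
  *-cancelˡ-nonZero {x} {y} {z} x≉0 xy≈xz with invertible x x≉0
  ... | x⁻¹ , x⁻¹x≈1 , _ = begin
    y               ≈⟨ *-identityˡ y ⟨
    1# * y          ≈⟨ *-congʳ x⁻¹x≈1 ⟨
    x⁻¹ * x * y     ≈⟨ *-assoc _ _ _ ⟩
    x⁻¹ * (x * y)   ≈⟨ *-congˡ xy≈xz ⟩
    x⁻¹ * (x * z)   ≈⟨ *-assoc _ _ _ ⟨
    x⁻¹ * x * z     ≈⟨ *-congʳ x⁻¹x≈1 ⟩
    1# * z          ≈⟨ *-identityˡ z ⟩
    z               ∎

  x*y≈0⇒y≈0 : ∀ {x y} → x ≉ 0# → x * y ≈ 0# → y ≈ 0#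
  x*y≈0⇒y≈0 x≉0 xy≈0 = *-cancelˡ-nonZero x≉0 (trans xy≈0 (sym (zeroʳ _)))

  -- Sums and products over the field run over indices, so a bijection of the field has to be
  -- carried over to `Fin N` before they can be reordered by it.
  carrierPermutation : (f g : Carrier → Carrier) →
    (∀ {x y} → x ≈ y → f x ≈ f y) → (∀ {x y} → x ≈ y → g x ≈ g y) →
    (∀ x → f (g x) ≈ x) → (∀ x → g (f x) ≈ x) → Permutation′ N
  carrierPermutation f g f-cong g-cong fg gf = permutation
    (index ∘ f ∘ element) (index ∘ g ∘ element)
    (λ i → ≡.trans (Inverse.to-cong finite (trans (f-cong (element-index _)) (fg _))) (index-element i))
    (λ i → ≡.trans (Inverse.to-cong finite (trans (g-cong (element-index _)) (gf _))) (index-element i))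

  -- Translating by 1 permutes the elements, so it does not change their sum.
  N×1≈0 : N ×ᴿ 1# ≈ 0#
  N×1≈0 = +-identityˡ-unique (N ×ᴿ 1#) (+.sum element) (begin
    N ×ᴿ 1# + +.sum element                      ≈⟨ +-congʳ (+.sum-replicate N) ⟨
    +.sum {N} (λ _ → 1#) + +.sum element         ≈⟨ +.∑-distrib-+ (λ _ → 1#) element ⟨
    +.sum (λ i → 1# + element i)                 ≈⟨ +.sum-cong-≋ (λ i → element-index (1# + element i)) ⟨
    +.sum (λ i → element (π ⟨$⟩ʳ i))             ≈⟨ +.sum-permute element π ⟨
    +.sum element                                ∎)
    where
    π : Permutation′ N
    π = carrierPermutation (1# +_) (- 1# +_) +-congˡ +-congˡ
      (λ x → trans (sym (+-assoc _ _ _)) (trans (+-congʳ (-‿inverseʳ 1#)) (+-identityˡ x)))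
      (λ x → trans (sym (+-assoc _ _ _)) (trans (+-congʳ (-‿inverseˡ 1#)) (+-identityˡ x)))

  -- The m-th power of p · 1 is N · 1 = 0, and a field has no zero divisors.
  characteristic : ∀ p m → N ≡ p ℕ.^ m → p ×ᴿ 1# ≈ 0#
  characteristic p m N≡p^m = go m (trans (×-congˡ (≡.sym N≡p^m)) N×1≈0)
    where
    go : ∀ m → (p ℕ.^ m) ×ᴿ 1# ≈ 0# → p ×ᴿ 1# ≈ 0#
    go zero    1≈0 = contradiction (trans (sym (+-identityʳ 1#)) 1≈0) 1≉0
    go (suc m) eq with p ×ᴿ 1# ≟ 0#
    ... | yes p×1≈0 = p×1≈0
    ... | no  p×1≉0 = go m (x*y≈0⇒y≈0 p×1≉0 (trans (sym (×1-homo-* p (p ℕ.^ m))) eq))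

  x^N≈x : ∀ x → x ^ N ≈ x
  x^N≈x a with a ≟ 0#
  -- `index 0#` inhabits `Fin N`, which excludes N = 0, where the power would be 1.
  ... | yes a≈0 = trans (^-congˡ N a≈0) (trans (0^n (index 0#)) (sym a≈0))
    where
    0^n : ∀ {n} → Fin n → 0# ^ n ≈ 0#
    0^n {suc n} _ = zeroˡ _
  -- Multiplication by a permutes the elements; compare the products of the nonzero ones.
  ... | no  a≉0 = trans a^N≈a*∏factor (trans (*-congˡ ∏factor≈1) (*-identityʳ a))
    where
    -- With 0 replaced by 1, the product over all of `Fin N` is the product of the nonzero elements
    -- and cannot vanish.
    nonZeroOr1 : ∀ x → Dec (x ≈ 0#) → Carrier
    nonZeroOr1 x (yes _) = 1#
    nonZeroOr1 x (no  _) = x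

    -- The ratio of `unit (a * x)` to `unit x`: it is a, except at x = 0, where both are 1.
    aOr1 : ∀ {x} → Dec (x ≈ 0#) → Carrier
    aOr1 (yes _) = 1#
    aOr1 (no  _) = a

    unit : Carrier → Carrier
    unit x = nonZeroOr1 x (x ≟ 0#)

    factor : Fin N → Carrier
    factor i = aOr1 (element i ≟ 0#)

    unit-* : ∀ {x y} → y ≈ a * x → unit y ≈ aOr1 (x ≟ 0#) * unit x
    unit-* {x} {y} y≈ax with x ≟ 0# | y ≟ 0#
    ... | yes _   | yes _   = sym (*-identityʳ 1#)
    ... | yes x≈0 | no  y≉0 = contradiction (trans y≈ax (trans (*-congˡ x≈0) (zeroʳ a))) y≉0
    ... | no  x≉0 | yes y≈0 = contradiction (x*y≈0⇒y≈0 a≉0 (trans (sym y≈ax) y≈0)) x≉0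
    ... | no  _   | no  _   = y≈ax

    unit≉0 : ∀ x → unit x ≉ 0#
    unit≉0 x with x ≟ 0#
    ... | yes _   = 1≉0
    ... | no  x≉0 = x≉0

    product≉0 : ∀ {n} (t : Fin n → Carrier) → (∀ i → t i ≉ 0#) → *.sum t ≉ 0#
    product≉0 {zero}  t t≉0 = 1≉0
    product≉0 {suc n} t t≉0 eq = product≉0 (tail t) (t≉0 ∘ suc) (x*y≈0⇒y≈0 (t≉0 zero) eq)

    π : Permutation′ N
    π with invertible a a≉0
    ... | b , ba≈1 , ab≈1 = carrierPermutation (a *_) (b *_) *-congˡ *-congˡ
      (λ x → trans (sym (*-assoc _ _ _)) (trans (*-congʳ ab≈1) (*-identityˡ x)))
      (λ x → trans (sym (*-assoc _ _ _)) (trans (*-congʳ ba≈1) (*-identityˡ x)))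

    π-spec : ∀ i → element (π ⟨$⟩ʳ i) ≈ a * element i
    π-spec i with invertible a a≉0
    ... | b , ba≈1 , ab≈1 = element-index _

    ∏factor≈1 : *.sum factor ≈ 1#
    ∏factor≈1 = *-cancelˡ-nonZero (product≉0 (unit ∘ element) (unit≉0 ∘ element)) (begin
      *.sum (unit ∘ element) * *.sum factor             ≈⟨ *-comm _ _ ⟩
      *.sum factor * *.sum (unit ∘ element)             ≈⟨ *.∑-distrib-+ factor (unit ∘ element) ⟨
      *.sum (λ i → factor i * unit (element i))         ≈⟨ *.sum-cong-≋ (λ i → unit-* (π-spec i)) ⟨
      *.sum (λ i → unit (element (π ⟨$⟩ʳ i)))           ≈⟨ *.sum-permute (unit ∘ element) π ⟨
      *.sum (unit ∘ element)                            ≈⟨ *-identityʳ _ ⟨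
      *.sum (unit ∘ element) * 1#                       ∎)

    -- All entries of t but the one at `i₀` equal a, so the product has one factor a too few; the
    -- extra a turns the exponent N - 1 of the nonzero elements into N.
    ^≈*product : ∀ {n} (i₀ : Fin n) (t : Fin n → Carrier) → t i₀ ≈ 1# →
                    (∀ i → i ≢ i₀ → t i ≈ a) → a ^ n ≈ a * *.sum t
    ^≈*product {suc n} i₀ t t₀≈1 t≈a = *-congˡ (begin
      a ^ n                             ≈⟨ *.sum-replicate n ⟨
      *.sum {n} (λ _ → a)               ≈⟨ *.sum-cong-≋ (λ j → t≈a (punchIn i₀ j) (Fin.punchInᵢ≢i i₀ j)) ⟨
      *.sum (removeAt t i₀)             ≈⟨ *-identityˡ _ ⟨
      1# * *.sum (removeAt t i₀)        ≈⟨ *-congʳ t₀≈1 ⟨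
      t i₀ * *.sum (removeAt t i₀)      ≈⟨ *.sum-remove t ⟨
      *.sum t                           ∎)

    aOr1-zero : ∀ {x} → x ≈ 0# → (d : Dec (x ≈ 0#)) → aOr1 d ≈ 1#
    aOr1-zero x≈0 (yes _)   = refl
    aOr1-zero x≈0 (no  x≉0) = contradiction x≈0 x≉0

    aOr1-nonZero : ∀ {x} → x ≉ 0# → (d : Dec (x ≈ 0#)) → aOr1 d ≈ a
    aOr1-nonZero x≉0 (yes x≈0) = contradiction x≈0 x≉0
    aOr1-nonZero x≉0 (no  _)   = refl

    a^N≈a*∏factor : a ^ N ≈ a * *.sum factor
    a^N≈a*∏factor = ^≈*product (index 0#) factor
      (aOr1-zero (element-index 0#) (element (index 0#) ≟ 0#))
      (λ i i≢ → aOr1-nonZero (λ eᵢ≈0 → i≢ (≡.trans (≡.sym (index-element i)) (Inverse.to-cong finite eᵢ≈0)))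
                             (element i ≟ 0#))

-- The commutative ring of coefficient lists

module PolynomialRing {c ℓ} (R : CommutativeRing c ℓ) where
  private module R = CommutativeRing R
  open R using (_≈_)
  open RingProperties R.ring using (-0#≈0#)
  open Polynomial R.rawRing

  -- _≈ᴾ_ wrapped in a record, so that both sides can be inferred.
  infix 4 _≋_
  record _≋_ (u v : Poly) : Set ℓ where
    constructor coeffwise
    field at : u ≈ᴾ v
  open _≋_ public

  scale : R.Carrier → Poly → Poly
  scale a = map (a R.*_)

  shift : Poly → Poly
  shift u = R.0# ∷ u

  ∷-cong : ∀ {a b u v} → a ≈ b → u ≋ v → a ∷ u ≋ b ∷ v
  ∷-cong a≈b u≋v .at zero    = a≈b
  ∷-cong a≈b u≋v .at (suc i) = u≋v .at i

  coeff-+ : ∀ u v i → coeff (u + v) i ≈ coeff u i R.+ coeff v i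
  coeff-+ []      v       i       = R.sym (R.+-identityˡ _)
  coeff-+ (a ∷ u) []      i       = R.sym (R.+-identityʳ _)
  coeff-+ (a ∷ u) (b ∷ v) zero    = R.refl
  coeff-+ (a ∷ u) (b ∷ v) (suc i) = coeff-+ u v i

  coeff-scale : ∀ a u i → coeff (scale a u) i ≈ a R.* coeff u i
  coeff-scale a []      i       = R.sym (R.zeroʳ a)
  coeff-scale a (b ∷ u) zero    = R.refl
  coeff-scale a (b ∷ u) (suc i) = coeff-scale a u i

  coeff-neg : ∀ u i → coeff (- u) i ≈ R.- coeff u i
  coeff-neg []      i       = R.sym -0#≈0#
  coeff-neg (b ∷ u) zero    = R.refl
  coeff-neg (b ∷ u) (suc i) = coeff-neg u i

  ≋-setoid : Setoid c ℓ
  ≋-setoid = record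
    { Carrier = Poly
    ; _≈_ = _≋_
    ; isEquivalence = record
      { refl  = λ where .at i → R.refl
      ; sym   = λ where e .at i → R.sym (e .at i)
      ; trans = λ where e e′ .at i → R.trans (e .at i) (e′ .at i)
      }
    }

  private module S = Setoid ≋-setoid

  +-cong : ∀ {u u′ v v′} → u ≋ u′ → v ≋ v′ → u + v ≋ u′ + v′
  +-cong {u} {u′} {v} {v′} e e′ .at i = begin
    coeff (u + v) i            ≈⟨ coeff-+ u v i ⟩
    coeff u i R.+ coeff v i    ≈⟨ R.+-cong (e .at i) (e′ .at i) ⟩
    coeff u′ i R.+ coeff v′ i  ≈⟨ coeff-+ u′ v′ i ⟨
    coeff (u′ + v′) i          ∎
    where open SetoidReasoning R.setoid

  +-congˡ : ∀ {u v v′} → v ≋ v′ → u + v ≋ u + v′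
  +-congˡ = +-cong S.refl

  +-assoc : ∀ u v w → (u + v) + w ≋ u + (v + w)
  +-assoc u v w .at i = begin
    coeff ((u + v) + w) i                       ≈⟨ coeff-+ (u + v) w i ⟩
    coeff (u + v) i R.+ coeff w i               ≈⟨ R.+-congʳ (coeff-+ u v i) ⟩
    coeff u i R.+ coeff v i R.+ coeff w i       ≈⟨ R.+-assoc _ _ _ ⟩
    coeff u i R.+ (coeff v i R.+ coeff w i)     ≈⟨ R.+-congˡ (coeff-+ v w i) ⟨
    coeff u i R.+ coeff (v + w) i               ≈⟨ coeff-+ u (v + w) i ⟨
    coeff (u + (v + w)) i                       ∎
    where open SetoidReasoning R.setoid

  +-comm : ∀ u v → u + v ≋ v + u
  +-comm u v .at i = begin
    coeff (u + v) i          ≈⟨ coeff-+ u v i ⟩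
    coeff u i R.+ coeff v i  ≈⟨ R.+-comm _ _ ⟩
    coeff v i R.+ coeff u i  ≈⟨ coeff-+ v u i ⟨
    coeff (v + u) i          ∎
    where open SetoidReasoning R.setoid

  +-identityʳ : ∀ u → u + 0# ≋ u
  +-identityʳ []      = S.refl
  +-identityʳ (a ∷ u) = S.refl

  neg-cong : ∀ {u v} → u ≋ v → - u ≋ - v
  neg-cong {u} {v} e .at i = begin
    coeff (- u) i   ≈⟨ coeff-neg u i ⟩
    R.- coeff u i   ≈⟨ R.-‿cong (e .at i) ⟩
    R.- coeff v i   ≈⟨ coeff-neg v i ⟨
    coeff (- v) i   ∎
    where open SetoidReasoning R.setoid

  neg-inverseʳ : ∀ u → u + - u ≋ 0#
  neg-inverseʳ u .at i = begin
    coeff (u + - u) i             ≈⟨ coeff-+ u (- u) i ⟩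
    coeff u i R.+ coeff (- u) i   ≈⟨ R.+-congˡ (coeff-neg u i) ⟩
    coeff u i R.+ R.- coeff u i   ≈⟨ R.-‿inverseʳ _ ⟩
    R.0#                          ∎
    where open SetoidReasoning R.setoid

  +-commutativeMonoid : CommutativeMonoid c ℓ
  +-commutativeMonoid = record
    { Carrier = Poly
    ; _≈_ = _≋_
    ; _∙_ = _+_
    ; ε = 0#
    ; isCommutativeMonoid = record
      { isMonoid = record
        { isSemigroup = record
          { isMagma = record { isEquivalence = S.isEquivalence ; ∙-cong = +-cong }
          ; assoc = +-assoc
          }
        ; identity = (λ u → S.refl) , +-identityʳ
        }
      ; comm = +-comm
      }
    }

  open CommutativeSemigroupProperties
    (CommutativeMonoid.commutativeSemigroup +-commutativeMonoid)
    using (interchange; x∙yz≈y∙xz)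

  scale-cong : ∀ {a b u v} → a ≈ b → u ≋ v → scale a u ≋ scale b v
  scale-cong {a} {b} {u} {v} a≈b e .at i = begin
    coeff (scale a u) i   ≈⟨ coeff-scale a u i ⟩
    a R.* coeff u i       ≈⟨ R.*-cong a≈b (e .at i) ⟩
    b R.* coeff v i       ≈⟨ coeff-scale b v i ⟨
    coeff (scale b v) i   ∎
    where open SetoidReasoning R.setoid

  scale-zero : ∀ u → scale R.0# u ≋ 0#
  scale-zero u .at i = R.trans (coeff-scale R.0# u i) (R.zeroˡ _)

  scale-one : ∀ u → scale R.1# u ≋ u
  scale-one u .at i = R.trans (coeff-scale R.1# u i) (R.*-identityˡ _)

  scale-scale : ∀ a b u → scale (a R.* b) u ≋ scale a (scale b u)
  scale-scale a b u .at i = begin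
    coeff (scale (a R.* b) u) i     ≈⟨ coeff-scale (a R.* b) u i ⟩
    a R.* b R.* coeff u i           ≈⟨ R.*-assoc _ _ _ ⟩
    a R.* (b R.* coeff u i)         ≈⟨ R.*-congˡ (coeff-scale b u i) ⟨
    a R.* coeff (scale b u) i       ≈⟨ coeff-scale a (scale b u) i ⟨
    coeff (scale a (scale b u)) i   ∎
    where open SetoidReasoning R.setoid

  scale-+ : ∀ a u v → scale a (u + v) ≋ scale a u + scale a v
  scale-+ a u v .at i = begin
    coeff (scale a (u + v)) i                       ≈⟨ coeff-scale a (u + v) i ⟩
    a R.* coeff (u + v) i                           ≈⟨ R.*-congˡ (coeff-+ u v i) ⟩
    a R.* (coeff u i R.+ coeff v i)                 ≈⟨ R.distribˡ _ _ _ ⟩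
    a R.* coeff u i R.+ a R.* coeff v i             ≈⟨ R.+-cong (coeff-scale a u i) (coeff-scale a v i) ⟨
    coeff (scale a u) i R.+ coeff (scale a v) i     ≈⟨ coeff-+ (scale a u) (scale a v) i ⟨
    coeff (scale a u + scale a v) i                 ∎
    where open SetoidReasoning R.setoid

  shift-zero : shift 0# ≋ 0#
  shift-zero .at zero    = R.refl
  shift-zero .at (suc i) = R.refl

  shift-+ : ∀ u v → shift (u + v) ≋ shift u + shift v
  shift-+ u v = ∷-cong (R.sym (R.+-identityˡ R.0#)) S.refl

  *-congˡ : ∀ u {v w} → v ≋ w → u * v ≋ u * w
  *-congˡ []      e = S.refl
  *-congˡ (a ∷ u) e = +-cong (scale-cong R.refl e) (∷-cong R.refl (*-congˡ u e))

  *-zeroʳ : ∀ u → u * 0# ≋ 0#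
  *-zeroʳ []      = S.refl
  *-zeroʳ (a ∷ u) = S.trans (∷-cong R.refl (*-zeroʳ u)) shift-zero

  -- Multiplication recurses on its left factor; this mirrored rule for the right factor is what
  -- commutativity needs.
  *-∷ʳ : ∀ u b v → u * (b ∷ v) ≋ scale b u + shift (u * v)
  *-∷ʳ []      b v = S.sym shift-zero
  *-∷ʳ (a ∷ u) b v = ∷-cong (R.+-congʳ (R.*-comm a b)) (begin
    scale a v + u * (b ∷ v)                    ≈⟨ +-congˡ (*-∷ʳ u b v) ⟩
    scale a v + (scale b u + shift (u * v))    ≈⟨ x∙yz≈y∙xz (scale a v) (scale b u) _ ⟩
    scale b u + (scale a v + shift (u * v))    ∎)
    where open SetoidReasoning ≋-setoid

  *-comm : ∀ u v → u * v ≋ v * u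
  *-comm []      v = S.sym (*-zeroʳ v)
  *-comm (a ∷ u) v = begin
    scale a v + shift (u * v)   ≈⟨ +-congˡ (∷-cong R.refl (*-comm u v)) ⟩
    scale a v + shift (v * u)   ≈⟨ *-∷ʳ v a u ⟨
    v * (a ∷ u)                 ∎
    where open SetoidReasoning ≋-setoid

  -- Equal polynomials may be lists of different lengths, so congruence in the left factor is
  -- obtained from the right one by commutativity instead of recursion on both lists.
  *-cong : ∀ {u u′ v v′} → u ≋ u′ → v ≋ v′ → u * v ≋ u′ * v′
  *-cong {u} {u′} {v} {v′} e e′ = begin
    u * v     ≈⟨ *-congˡ u e′ ⟩
    u * v′    ≈⟨ *-comm u v′ ⟩
    v′ * u    ≈⟨ *-congˡ v′ e ⟩
    v′ * u′   ≈⟨ *-comm v′ u′ ⟩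
    u′ * v′   ∎
    where open SetoidReasoning ≋-setoid

  *-distribˡ-+ : ∀ u v w → u * (v + w) ≋ u * v + u * w
  *-distribˡ-+ []      v w = S.refl
  *-distribˡ-+ (a ∷ u) v w = begin
    scale a (v + w) + shift (u * (v + w))
      ≈⟨ +-cong (scale-+ a v w) (∷-cong R.refl (*-distribˡ-+ u v w)) ⟩
    (scale a v + scale a w) + shift (u * v + u * w)
      ≈⟨ +-congˡ (shift-+ (u * v) (u * w)) ⟩
    (scale a v + scale a w) + (shift (u * v) + shift (u * w))
      ≈⟨ interchange (scale a v) (scale a w) (shift (u * v)) (shift (u * w)) ⟩
    (scale a v + shift (u * v)) + (scale a w + shift (u * w))
      ∎
    where open SetoidReasoning ≋-setoid

  *-distribʳ-+ : ∀ u v w → (v + w) * u ≋ v * u + w * u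
  *-distribʳ-+ u v w = begin
    (v + w) * u     ≈⟨ *-comm (v + w) u ⟩
    u * (v + w)     ≈⟨ *-distribˡ-+ u v w ⟩
    u * v + u * w   ≈⟨ +-cong (*-comm u v) (*-comm u w) ⟩
    v * u + w * u   ∎
    where open SetoidReasoning ≋-setoid

  scale-* : ∀ a u v → scale a u * v ≋ scale a (u * v)
  scale-* a []      v = S.refl
  scale-* a (b ∷ u) v = begin
    scale (a R.* b) v + shift (scale a u * v)
      ≈⟨ +-cong (scale-scale a b v) (∷-cong (R.sym (R.zeroʳ a)) (scale-* a u v)) ⟩
    scale a (scale b v) + scale a (shift (u * v))
      ≈⟨ scale-+ a (scale b v) (shift (u * v)) ⟨
    scale a (scale b v + shift (u * v))
      ∎
    where open SetoidReasoning ≋-setoid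

  shift-* : ∀ u v → shift u * v ≋ shift (u * v)
  shift-* u v = +-cong (scale-zero v) S.refl

  *-assoc : ∀ u v w → (u * v) * w ≋ u * (v * w)
  *-assoc []      v w = S.refl
  *-assoc (a ∷ u) v w = begin
    (scale a v + shift (u * v)) * w
      ≈⟨ *-distribʳ-+ w (scale a v) (shift (u * v)) ⟩
    scale a v * w + shift (u * v) * w
      ≈⟨ +-cong (scale-* a v w) (shift-* (u * v) w) ⟩
    scale a (v * w) + shift ((u * v) * w)
      ≈⟨ +-congˡ (∷-cong R.refl (*-assoc u v w)) ⟩
    scale a (v * w) + shift (u * (v * w))
      ∎
    where open SetoidReasoning ≋-setoid

  *-identityˡ : ∀ u → 1# * u ≋ u
  *-identityˡ u = begin
    scale R.1# u + shift 0#  ≈⟨ +-cong (scale-one u) shift-zero ⟩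
    u + 0#                   ≈⟨ +-identityʳ u ⟩
    u                        ∎
    where open SetoidReasoning ≋-setoid

  polynomialRing : CommutativeRing c ℓ
  polynomialRing = record
    { Carrier = Poly
    ; _≈_ = _≋_
    ; _+_ = _+_
    ; _*_ = _*_
    ; -_  = -_
    ; 0#  = 0#
    ; 1#  = 1#
    ; isCommutativeRing = record
      { isRing = record
        { +-isAbelianGroup = record
          { isGroup = record
            { isMonoid = CommutativeMonoid.isMonoid +-commutativeMonoid
            ; inverse = (λ u → S.trans (+-comm (- u) u) (neg-inverseʳ u)) , neg-inverseʳ
            ; ⁻¹-cong = neg-cong
            }
          ; comm = +-comm
          }
        ; *-cong = *-cong
        ; *-assoc = *-assoc
        ; *-identity = *-identityˡ , λ u → S.trans (*-comm u 1#) (*-identityˡ u)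
        ; distrib = *-distribˡ-+ , *-distribʳ-+
        }
      ; *-comm = *-comm
      }
    }

-- Division with remainder, common divisors, and the polynomial xⁿ - 1

module PolynomialDivision {c ℓ} (R : CommutativeRing c ℓ) where
  private
    module R = CommutativeRing R
  open R using (_≈_; _≉_)
  open Polynomial R.rawRing
  open PolynomialRing R
  private
    module P = CommutativeRing polynomialRing
    open CommutativeSemigroupProperties P.+-commutativeSemigroup using (x∙yz≈y∙xz)
  open RingProperties P.ring using (x∙y⁻¹≈ε⇒x≈y; [y-z]x≈yx-zx)

  -- A bound instead of a degree: no leading coefficient has to be located, and the zero polynomial
  -- satisfies every bound.
  Deg< : ℕ → Poly → Set ℓ
  Deg< d u = ∀ i → d ℕ.≤ i → coeff u i ≈ R.0#

  Deg<-tail : ∀ {d a u} → Deg< d u → Deg< (suc d) (a ∷ u)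
  Deg<-tail deg (suc i) (s≤s d≤i) = deg i d≤i

  Deg<-length : ∀ u → Deg< (length u) u
  Deg<-length []      i       _         = R.refl
  Deg<-length (a ∷ u) (suc i) (s≤s l≤i) = Deg<-length u i l≤i

  coeff-sub-scale : ∀ u s v i → coeff (u + - scale s v) i ≈ coeff u i R.- s R.* coeff v i
  coeff-sub-scale u s v i = begin
    coeff (u + - scale s v) i                 ≈⟨ coeff-+ u (- scale s v) i ⟩
    coeff u i R.+ coeff (- scale s v) i       ≈⟨ R.+-congˡ (coeff-neg (scale s v) i) ⟩
    coeff u i R.- coeff (scale s v) i         ≈⟨ R.+-congˡ (R.-‿cong (coeff-scale s v i)) ⟩
    coeff u i R.- s R.* coeff v i             ∎
    where open SetoidReasoning R.setoid

  -- From u = t m + r follows a + x u = (x t) m + (a + x r). The new remainder a + x r may have a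
  -- term in x^d; as b inverts the leading coefficient of m, subtracting s m removes it.
  divide : ∀ {m d b} → Deg< (suc d) m → coeff m d R.* b ≈ R.1# →
           ∀ u → ∃[ t ] ∃[ r ] u ≋ t * m + r × Deg< d r
  divide         deg lead [] = [] , [] , P.refl , λ _ _ → R.refl
  divide {m} {d} {b} deg lead (a ∷ u) with divide deg lead u
  ... | t , r , u≋ , deg-r = s ∷ t , r′ + - scale s m , eq , deg-r″
    where
    r′ : Poly
    r′ = a ∷ r
    s : R.Carrier
    s = coeff r′ d R.* b
    eq : a ∷ u ≋ (s ∷ t) * m + (r′ + - scale s m)
    eq = begin
      a ∷ u                                           ≈⟨ ∷-cong (R.sym (R.+-identityˡ a)) u≋ ⟩
      shift (t * m) + r′                              ≈⟨ P.+-identityʳ _ ⟨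
      (shift (t * m) + r′) + 0#                       ≈⟨ +-congˡ {shift (t * m) + r′} (neg-inverseʳ (scale s m)) ⟨
      (shift (t * m) + r′) + (scale s m + - scale s m)
        ≈⟨ x∙yz≈y∙xz (shift (t * m) + r′) (scale s m) (- scale s m) ⟩
      scale s m + ((shift (t * m) + r′) + - scale s m)
        ≈⟨ +-congˡ {scale s m} (+-assoc (shift (t * m)) r′ (- scale s m)) ⟩
      scale s m + (shift (t * m) + (r′ + - scale s m)) ≈⟨ P.+-assoc (scale s m) (shift (t * m)) _ ⟨
      (s ∷ t) * m + (r′ + - scale s m)                ∎
      where open SetoidReasoning P.setoid
    deg-r″ : Deg< d (r′ + - scale s m)
    deg-r″ i d≤i = R.trans (coeff-sub-scale r′ s m i) (vanish (ℕ.m≤n⇒m<n∨m≡n d≤i))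
      where
      open SetoidReasoning R.setoid
      vanish : d ℕ.< i ⊎ d ≡ i → coeff r′ i R.- s R.* coeff m i ≈ R.0#
      vanish (inj₁ d<i) = begin
        coeff r′ i R.- s R.* coeff m i
          ≈⟨ R.+-cong (Deg<-tail deg-r i d<i) (R.-‿cong (R.trans (R.*-congˡ (deg i d<i)) (R.zeroʳ s))) ⟩
        R.0# R.- R.0#
          ≈⟨ R.-‿inverseʳ R.0# ⟩
        R.0# ∎
      vanish (inj₂ ≡.refl) = begin
        coeff r′ d R.- coeff r′ d R.* b R.* coeff m d
          ≈⟨ R.+-congˡ (R.-‿cong (R.*-assoc _ _ _)) ⟩
        coeff r′ d R.- coeff r′ d R.* (b R.* coeff m d)
          ≈⟨ R.+-congˡ (R.-‿cong (R.*-congˡ (R.trans (R.*-comm _ _) lead))) ⟩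
        coeff r′ d R.- coeff r′ d R.* R.1#
          ≈⟨ R.+-congˡ (R.-‿cong (R.*-identityʳ _)) ⟩
        coeff r′ d R.- coeff r′ d
          ≈⟨ R.-‿inverseʳ _ ⟩
        R.0# ∎

  ∣-combine : ∀ {D g h r} t → g ≋ t * h + r → D ∣ h → D ∣ r → D ∣ g
  ∣-combine {D} {g} {h} {r} t g≋ (x , xD≈h) (y , yD≈r) = t * x + y , at (begin
    (t * x + y) * D        ≈⟨ P.distribʳ D (t * x) y ⟩
    t * x * D + y * D      ≈⟨ +-cong (P.*-assoc t x D) (coeffwise yD≈r) ⟩
    t * (x * D) + r        ≈⟨ +-cong (*-congˡ t (coeffwise xD≈h)) P.refl ⟩
    t * h + r              ≈⟨ g≋ ⟨
    g                      ∎)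
    where open SetoidReasoning P.setoid

  module _ (_≟_ : Decidable₂ _≈_)
           (inverse : ∀ x → x ≉ R.0# → ∃[ y ] x R.* y ≈ R.1#)
           where

    -- I stands for an ideal; closure under remainders is all the algorithm needs.
    euclid : ∀ {i} (I : Poly → Set i) →
             (∀ {g h r} t → g ≋ t * h + r → I g → I h → I r) →
             ∀ d g h → Deg< d h → ∃[ D ] D ∣ g × D ∣ h × (I g → I h → I D)
    -- The bound 0 means that h = 0, so g itself is the common divisor sought.
    euclid I remainder zero    g h deg =
      g , (1# , at (P.*-identityˡ g)) , (0# , λ i → R.sym (deg i z≤n)) , λ g∈I _ → g∈I
    euclid I remainder (suc d) g h deg with coeff h d ≟ R.0#
    -- The recursion is on the bound, not the degree: a vanishing top coefficient lowers the bound
    -- without a division.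
    ... | yes lead≈0 = euclid I remainder d g h deg′
      where
      deg′ : Deg< d h
      deg′ i d≤i with ℕ.m≤n⇒m<n∨m≡n d≤i
      ... | inj₁ d<i    = deg i d<i
      ... | inj₂ ≡.refl = lead≈0
    ... | no lead≉0 =
      let b , lead*b≈1 = inverse (coeff h d) lead≉0
          t , r , g≋ , deg-r = divide deg lead*b≈1 g
          D , D∣h , D∣r , D∈I = euclid I remainder d h r deg-r
      in D , ∣-combine t g≋ D∣h D∣r , D∣h , λ g∈I h∈I → D∈I h∈I (remainder t g≋ g∈I h∈I)

  -- Coefficients are killed from the bottom up: the constant term of (a + x s) m is a times a unit,
  -- hence a = 0, and what remains is x s m = 0.
  *≈0⇒≈0 : ∀ {m b} → coeff m 0 R.* b ≈ R.1# → ∀ s → s * m ≋ 0# → s ≋ 0#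
  *≈0⇒≈0         const []      e = P.refl
  *≈0⇒≈0 {m} {b} const (a ∷ s) e =
    P.trans (∷-cong a≈0 (*≈0⇒≈0 const s (coeffwise sm≈0))) shift-zero
    where
    open SetoidReasoning R.setoid
    a≈0 : a ≈ R.0#
    a≈0 = begin
      a                                                       ≈⟨ R.*-identityʳ a ⟨
      a R.* R.1#                                              ≈⟨ R.*-congˡ const ⟨
      a R.* (coeff m 0 R.* b)                                 ≈⟨ R.*-assoc _ _ _ ⟨
      a R.* coeff m 0 R.* b                                   ≈⟨ R.*-congʳ (coeff-scale a m 0) ⟨
      coeff (scale a m) 0 R.* b                               ≈⟨ R.*-congʳ (R.+-identityʳ _) ⟨
      (coeff (scale a m) 0 R.+ coeff (shift (s * m)) 0) R.* b ≈⟨ R.*-congʳ (coeff-+ (scale a m) (shift (s * m)) 0) ⟨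
      coeff ((a ∷ s) * m) 0 R.* b                             ≈⟨ R.*-congʳ (e .at 0) ⟩
      R.0# R.* b                                              ≈⟨ R.zeroˡ b ⟩
      R.0#                                                    ∎
    sm≈0 : ∀ i → coeff (s * m) i ≈ R.0#
    sm≈0 i = begin
      coeff (s * m) i                                         ≈⟨ R.+-identityˡ _ ⟨
      R.0# R.+ coeff (s * m) i                                ≈⟨ R.+-congʳ (R.zeroˡ _) ⟨
      R.0# R.* coeff m (suc i) R.+ coeff (s * m) i            ≈⟨ R.+-congʳ (R.*-congʳ a≈0) ⟨
      a R.* coeff m (suc i) R.+ coeff (s * m) i               ≈⟨ R.+-congʳ (coeff-scale a m (suc i)) ⟨
      coeff (scale a m) (suc i) R.+ coeff (s * m) i           ≈⟨ coeff-+ (scale a m) (shift (s * m)) (suc i) ⟨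
      coeff ((a ∷ s) * m) (suc i)                             ≈⟨ e .at (suc i) ⟩
      R.0#                                                    ∎

  *-cancelʳ : ∀ {m b} → coeff m 0 R.* b ≈ R.1# → ∀ u v → u * m ≋ v * m → u ≋ v
  *-cancelʳ {m} const u v e = x∙y⁻¹≈ε⇒x≈y u v (*≈0⇒≈0 const (u + - v) (begin
    (u + - v) * m         ≈⟨ [y-z]x≈yx-zx m u v ⟩
    u * m + - (v * m)     ≈⟨ +-cong e P.refl ⟩
    v * m + - (v * m)     ≈⟨ neg-inverseʳ (v * m) ⟩
    0#                    ∎))
    where open SetoidReasoning P.setoid

  ∣-trans : ∀ {u v w} → u ∣ v → v ∣ w → u ∣ w
  ∣-trans {u} {v} {w} (s , su≈v) (t , tv≈w) = t * s , at (begin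
    t * s * u     ≈⟨ *-assoc t s u ⟩
    t * (s * u)   ≈⟨ *-congˡ t (coeffwise su≈v) ⟩
    t * v         ≈⟨ coeffwise tv≈w ⟩
    w             ∎)
    where open SetoidReasoning P.setoid

  -- Here t w m = v w = m, and m can be cancelled.
  ∣cofactor⇒∣1 : ∀ {m b} → coeff m 0 R.* b ≈ R.1# → ∀ {v w t} → v * w ≋ m → v ≋ t * m → w ∣ 1#
  ∣cofactor⇒∣1 {m} const {v} {w} {t} vw≋m v≋tm = t , at (*-cancelʳ const (t * w) 1# (begin
    t * w * m          ≈⟨ *-assoc t w m ⟩
    t * (w * m)        ≈⟨ *-congˡ t (*-comm w m) ⟩
    t * (m * w)        ≈⟨ *-assoc t m w ⟨
    t * m * w          ≈⟨ *-cong v≋tm P.refl ⟨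
    v * w              ≈⟨ vw≋m ⟩
    m                  ≈⟨ *-identityˡ m ⟨
    1# * m             ∎))
    where open SetoidReasoning P.setoid

  coprime⇒IsGCD-1 : ∀ {u v} → (∀ {w} → w ∣ u → w ∣ v → w ∣ 1#) → IsGCD u v 1#
  coprime⇒IsGCD-1 {u} {v} coprime = record
    { monic    = 0 , R.refl , λ where (suc i) _ → R.refl
    ; ∣ˡ       = u , at (P.*-identityʳ u)
    ; ∣ʳ       = v , at (P.*-identityʳ v)
    ; greatest = coprime
    }

  X*≋shift : ∀ u → X * u ≋ shift u
  X*≋shift u = begin
    scale R.0# u + shift (1# * u)   ≈⟨ +-cong (scale-zero u) (∷-cong R.refl (P.*-identityˡ u)) ⟩
    shift u                         ∎
    where open SetoidReasoning P.setoid

  coeff-X^-top : ∀ n → coeff (X ^ n) n ≈ R.1#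
  coeff-X^-top zero    = R.refl
  coeff-X^-top (suc n) = R.trans (X*≋shift (X ^ n) .at (suc n)) (coeff-X^-top n)

  Deg<-X^ : ∀ n → Deg< (suc n) (X ^ n)
  Deg<-X^ zero    (suc i) _         = R.refl
  Deg<-X^ (suc n) (suc i) (s≤s n<i) = R.trans (X*≋shift (X ^ n) .at (suc i)) (Deg<-X^ n i n<i)

  X^n-1 : ℕ → Poly
  X^n-1 n = X ^ n + - 1#

  private
    -1+ : ∀ n i → coeff (X^n-1 (suc n)) (suc i) ≈ coeff (X ^ suc n) (suc i)
    -1+ n i = R.trans (coeff-+ (X ^ suc n) (- 1#) (suc i)) (R.+-identityʳ _)

  -- The constant term is -1, its own inverse; for n = 0 the polynomial would be 0.
  coeff-X^n-1-const : ∀ n .{{_ : NonZero n}} → coeff (X^n-1 n) 0 R.* (R.- R.1#) ≈ R.1#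
  coeff-X^n-1-const (suc n) = begin
    coeff (X^n-1 (suc n)) 0 R.* (R.- R.1#)              ≈⟨ R.*-congʳ (coeff-+ (X ^ suc n) (- 1#) 0) ⟩
    (coeff (X ^ suc n) 0 R.+ R.- R.1#) R.* (R.- R.1#)   ≈⟨ R.*-congʳ (R.+-congʳ (X*≋shift (X ^ n) .at 0)) ⟩
    (R.0# R.+ R.- R.1#) R.* (R.- R.1#)                  ≈⟨ R.*-congʳ (R.+-identityˡ _) ⟩
    (R.- R.1#) R.* (R.- R.1#)                           ≈⟨ -1*x≈-x (R.- R.1#) ⟩
    R.- R.- R.1#                                        ≈⟨ -‿involutive R.1# ⟩
    R.1#                                                ∎
    where
    open SetoidReasoning R.setoid
    open RingProperties R.ring using (-1*x≈-x; -‿involutive)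

  coeff-X^n-1-top : ∀ n .{{_ : NonZero n}} → coeff (X^n-1 n) n R.* R.1# ≈ R.1#
  coeff-X^n-1-top (suc n) =
    R.trans (R.*-identityʳ _) (R.trans (-1+ n n) (coeff-X^-top (suc n)))

  Deg<-X^n-1 : ∀ n .{{_ : NonZero n}} → Deg< (suc n) (X^n-1 n)
  Deg<-X^n-1 (suc n) (suc i) n<i = R.trans (-1+ n i) (Deg<-X^ (suc n) (suc i) n<i)

-- Evaluation of polynomials, also along a ring homomorphism

module EvaluationVia {c₁ ℓ₁ c₂ ℓ₂} (F : CommutativeRing c₁ ℓ₁) (K : CommutativeRing c₂ ℓ₂) where
  private
    module F = CommutativeRing F
    module K = CommutativeRing K
  open Polynomial F.rawRing
  open Polynomial K.rawRing using () renaming (eval to evalᴷ)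
  open Exp K.commutativeSemiring using () renaming (_^_ to _^ᴷ_)
  open Sum K.semiring using () renaming (sum to sumᴷ)
  open RingSolver K.commutativeSemiring using (solve; _:=_; _:+_; _:*_)

  module _ (ι : F.Carrier → K.Carrier) (ι-hom : RingMorphisms.IsRingHomomorphism F.rawRing K.rawRing ι) where
    open RingMorphisms.IsRingHomomorphism ι-hom
    open K using (_≈_)
    open SetoidReasoning K.setoid

    ev : Poly → K.Carrier → K.Carrier
    ev u = evalᴷ (map ι u)

    ev-cong : ∀ u {x y} → x ≈ y → ev u x ≈ ev u y
    ev-cong []      x≈y = K.refl
    ev-cong (a ∷ u) x≈y = K.+-congˡ (K.*-cong x≈y (ev-cong u x≈y))

    ev-+ : ∀ u v x → ev (u + v) x ≈ ev u x K.+ ev v x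
    ev-+ []      v       x = K.sym (K.+-identityˡ _)
    ev-+ (a ∷ u) []      x = K.sym (K.+-identityʳ _)
    ev-+ (a ∷ u) (b ∷ v) x = begin
      ι (a F.+ b) K.+ x K.* ev (u + v) x                      ≈⟨ K.+-cong (+-homo a b) (K.*-congˡ (ev-+ u v x)) ⟩
      (ι a K.+ ι b) K.+ x K.* (ev u x K.+ ev v x)
        ≈⟨ solve 5 (λ a b x u v → (a :+ b) :+ x :* (u :+ v) := (a :+ x :* u) :+ (b :+ x :* v)) K.refl
             (ι a) (ι b) x (ev u x) (ev v x) ⟩
      (ι a K.+ x K.* ev u x) K.+ (ι b K.+ x K.* ev v x)       ∎

    ev-scale : ∀ a u x → ev (map (a F.*_) u) x ≈ ι a K.* ev u x
    ev-scale a []      x = K.sym (K.zeroʳ _)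
    ev-scale a (b ∷ u) x = begin
      ι (a F.* b) K.+ x K.* ev (map (a F.*_) u) x     ≈⟨ K.+-cong (*-homo a b) (K.*-congˡ (ev-scale a u x)) ⟩
      ι a K.* ι b K.+ x K.* (ι a K.* ev u x)
        ≈⟨ solve 4 (λ a b x u → a :* b :+ x :* (a :* u) := a :* (b :+ x :* u)) K.refl (ι a) (ι b) x (ev u x) ⟩
      ι a K.* (ι b K.+ x K.* ev u x)                  ∎

    ev-* : ∀ u v x → ev (u * v) x ≈ ev u x K.* ev v x
    ev-* []      v x = K.sym (K.zeroˡ _)
    ev-* (a ∷ u) v x = begin
      ev (map (a F.*_) v + (F.0# ∷ u * v)) x              ≈⟨ ev-+ (map (a F.*_) v) (F.0# ∷ u * v) x ⟩
      ev (map (a F.*_) v) x K.+ (ι F.0# K.+ x K.* ev (u * v) x)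
        ≈⟨ K.+-cong (ev-scale a v x) (K.trans (K.+-cong 0#-homo (K.*-congˡ (ev-* u v x))) (K.+-identityˡ _)) ⟩
      ι a K.* ev v x K.+ x K.* (ev u x K.* ev v x)
        ≈⟨ solve 4 (λ a x u v → a :* v :+ x :* (u :* v) := (a :+ x :* u) :* v) K.refl (ι a) x (ev u x) (ev v x) ⟩
      (ι a K.+ x K.* ev u x) K.* ev v x                   ∎

    ev-C : ∀ a x → ev (C a) x ≈ ι a
    ev-C a x = K.trans (K.+-congˡ (K.zeroʳ x)) (K.+-identityʳ _)

    ev-X : ∀ x → ev X x ≈ x
    ev-X x = begin
      ι F.0# K.+ x K.* ev (C F.1#) x  ≈⟨ K.+-cong 0#-homo (K.*-congˡ (K.trans (ev-C F.1# x) 1#-homo)) ⟩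
      K.0# K.+ x K.* K.1#             ≈⟨ K.+-identityˡ _ ⟩
      x K.* K.1#                      ≈⟨ K.*-identityʳ x ⟩
      x                               ∎

    ev-X^ : ∀ m x → ev (X ^ m) x ≈ x ^ᴷ m
    ev-X^ zero    x = K.trans (ev-C F.1# x) 1#-homo
    ev-X^ (suc m) x = K.trans (ev-* X (X ^ m) x) (K.*-cong (ev-X x) (ev-X^ m x))

    ev-sum : ∀ {m} (t : Fin m → Poly) x → ev (sum t) x ≈ sumᴷ (λ i → ev (t i) x)
    ev-sum {zero}  t x = K.refl
    ev-sum {suc m} t x = K.trans (ev-+ (t zero) _ x) (K.+-congˡ (ev-sum (t ∘ suc) x))

module Evaluation {c ℓ} (K : CommutativeRing c ℓ) where
  private module K = CommutativeRing K
  open K using (_≈_)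
  open Polynomial K.rawRing
  open Exp K.commutativeSemiring using () renaming (_^_ to _^ᴷ_)
  private module Id = EvaluationVia K K
  private
    -- The laws for `eval` are those for `ev` along the identity homomorphism; this equation removes
    -- the `map id`.
    ev-id : ∀ u x → eval (map id u) x ≡ eval u x
    ev-id u x = ≡.cong (λ v → eval v x) (map-id u)
    id-hom = isRingHomomorphism K.rawRing K.refl

  eval-cong : ∀ u {x y} → x ≈ y → eval u x ≈ eval u y
  eval-cong u {x} {y} x≈y = ≡.subst₂ _≈_ (ev-id u x) (ev-id u y) (Id.ev-cong id id-hom u x≈y)

  eval-+ : ∀ u v x → eval (u + v) x ≈ eval u x K.+ eval v x
  eval-+ u v x = ≡.subst₂ _≈_ (ev-id (u + v) x) (≡.cong₂ K._+_ (ev-id u x) (ev-id v x))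
                   (Id.ev-+ id id-hom u v x)

  eval-* : ∀ u v x → eval (u * v) x ≈ eval u x K.* eval v x
  eval-* u v x = ≡.subst₂ _≈_ (ev-id (u * v) x) (≡.cong₂ K._*_ (ev-id u x) (ev-id v x))
                   (Id.ev-* id id-hom u v x)

  eval-scale : ∀ a u x → eval (map (a K.*_) u) x ≈ a K.* eval u x
  eval-scale a u x = ≡.subst₂ _≈_ (ev-id (map (a K.*_) u) x) (≡.cong (a K.*_) (ev-id u x))
                       (Id.ev-scale id id-hom a u x)

  eval-X^ : ∀ m x → eval (X ^ m) x ≈ x ^ᴷ m
  eval-X^ m x = ≡.subst (_≈ x ^ᴷ m) (ev-id (X ^ m) x) (Id.ev-X^ id id-hom m x)

  eval-∘ : ∀ u v x → eval (u ∘ᴾ v) x ≈ eval u (eval v x)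
  eval-∘ []      v x = K.refl
  eval-∘ (a ∷ u) v x = begin
    eval (C a + v * (u ∘ᴾ v)) x                 ≈⟨ eval-+ (C a) (v * (u ∘ᴾ v)) x ⟩
    eval (C a) x K.+ eval (v * (u ∘ᴾ v)) x      ≈⟨ K.+-cong (K.trans (K.+-congˡ (K.zeroʳ x)) (K.+-identityʳ a))
                                                            (eval-* v (u ∘ᴾ v) x) ⟩
    a K.+ eval v x K.* eval (u ∘ᴾ v) x          ≈⟨ K.+-congˡ (K.*-congˡ (eval-∘ u v x)) ⟩
    a K.+ eval v x K.* eval u (eval v x)        ∎
    where open SetoidReasoning K.setoid

  eval-null : ∀ u x → u ≈ᴾ 0# → eval u x ≈ K.0#
  eval-null []      x u≈0 = K.refl
  eval-null (a ∷ u) x u≈0 =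
    K.trans (K.+-cong (u≈0 0) (K.trans (K.*-congˡ (eval-null u x (u≈0 ∘ suc))) (K.zeroʳ x)))
            (K.+-identityʳ K.0#)

-- A nonzero polynomial has no more roots than its degree

module Roots {c ℓ N} (𝔽 : FiniteField c ℓ N) where
  private module K = FiniteField 𝔽
  open K using (_≈_)
  open Polynomial K.rawRing
  open PolynomialRing K.commutativeRing
  open PolynomialDivision K.commutativeRing
  open Evaluation K.commutativeRing
  open FiniteFieldProperties 𝔽
  open RingProperties K.ring using (x∙y⁻¹≈ε⇒x≈y; [y-z]x≈yx-zx)

  -- The quotient of u by X − r.
  syntheticQuotient : K.Carrier → Poly → Poly
  syntheticQuotient r []      = []
  syntheticQuotient r (a ∷ u) = u + scale r (syntheticQuotient r u)

  module _ (r : K.Carrier) where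
    private
      s : Poly → Poly
      s = syntheticQuotient r
    open SetoidReasoning K.setoid
    open RingSolver K.commutativeSemiring using (solve; _:=_; _:+_; _:*_)

    eval-cons-quotient : ∀ a u x → eval (s (a ∷ u)) x ≈ eval u x K.+ r K.* eval (s u) x
    eval-cons-quotient a u x = K.trans (eval-+ u (scale r (s u)) x) (K.+-congˡ (eval-scale r (s u) x))

    -- u(x) − u(r) = (x − r) · s(x), with both sides moved so that no subtraction occurs.
    eval-quotient : ∀ u x → eval u x K.+ r K.* eval (s u) x ≈ eval u r K.+ x K.* eval (s u) x
    eval-quotient []      x = K.+-congˡ (K.trans (K.zeroʳ r) (K.sym (K.zeroʳ x)))
    eval-quotient (a ∷ u) x = begin
      (a K.+ x K.* U) K.+ r K.* eval (s (a ∷ u)) x     ≈⟨ K.+-congˡ (K.*-congˡ (eval-cons-quotient a u x)) ⟩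
      (a K.+ x K.* U) K.+ r K.* (U K.+ r K.* S)        ≈⟨ K.+-congˡ (K.*-congˡ (eval-quotient u x)) ⟩
      (a K.+ x K.* U) K.+ r K.* (Uᵣ K.+ x K.* S)
        ≈⟨ solve 6 (λ a x r u s v → (a :+ x :* u) :+ r :* (v :+ x :* s) := (a :+ r :* v) :+ x :* (u :+ r :* s))
             K.refl a x r U S Uᵣ ⟩
      (a K.+ r K.* Uᵣ) K.+ x K.* (U K.+ r K.* S)       ≈⟨ K.+-congˡ (K.*-congˡ (eval-cons-quotient a u x)) ⟨
      (a K.+ r K.* Uᵣ) K.+ x K.* eval (s (a ∷ u)) x    ∎
      where
      U Uᵣ S : K.Carrier
      U = eval u x
      Uᵣ = eval u r
      S = eval (s u) x

    coeff-cons-quotient : ∀ a u i → coeff (s (a ∷ u)) i ≈ coeff u i K.+ r K.* coeff (s u) i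
    coeff-cons-quotient a u i = K.trans (coeff-+ u (scale r (s u)) i) (K.+-congˡ (coeff-scale r (s u) i))

    -- The coefficient of x^(i+1) in u = u(r) + (x - r) s, with the subtracted term moved to the
    -- other side.
    coeff-quotient : ∀ u i → coeff u (suc i) K.+ r K.* coeff (s u) (suc i) ≈ coeff (s u) i
    coeff-quotient []      i = K.trans (K.+-identityˡ _) (K.zeroʳ r)
    coeff-quotient (a ∷ u) i = begin
      coeff u i K.+ r K.* coeff (s (a ∷ u)) (suc i)     ≈⟨ K.+-congˡ (K.*-congˡ (coeff-cons-quotient a u (suc i))) ⟩
      coeff u i K.+ r K.* (coeff u (suc i) K.+ r K.* coeff (s u) (suc i))
                                                        ≈⟨ K.+-congˡ (K.*-congˡ (coeff-quotient u i)) ⟩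
      coeff u i K.+ r K.* coeff (s u) i                 ≈⟨ coeff-cons-quotient a u i ⟨
      coeff (s (a ∷ u)) i                               ∎

    Deg<-quotient : ∀ {m} u → Deg< (suc m) u → Deg< m (s u)
    Deg<-quotient []      deg i m≤i = K.refl
    Deg<-quotient {m} (a ∷ u) deg i m≤i = begin
      coeff (s (a ∷ u)) i                ≈⟨ coeff-cons-quotient a u i ⟩
      -- The tail has degree below m; weakening this to m + 1 lets the induction hypothesis return
      -- the bound m itself, with no separate case m = 0.
      coeff u i K.+ r K.* coeff (s u) i  ≈⟨ K.+-cong (deg-u i m≤i) (K.*-congˡ (Deg<-quotient u
                                              (λ j m<j → deg-u j (ℕ.<⇒≤ m<j)) i m≤i)) ⟩
      K.0# K.+ r K.* K.0#                ≈⟨ K.trans (K.+-identityˡ _) (K.zeroʳ r) ⟩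
      K.0#                               ∎
      where
      deg-u : Deg< m u
      deg-u j m≤j = deg (suc j) (s≤s m≤j)

  -- Division by x - r₀ lowers the bound by one, and the quotient keeps the other roots because they
  -- differ from r₀. Once the quotient is 0, u is constant, and its root r₀ makes that constant 0.
  Deg<∧roots⇒≈0 : ∀ m (r : Fin m → K.Carrier) → (∀ {i j} → r i ≈ r j → i ≡ j) →
                  ∀ u → Deg< m u → (∀ i → eval u (r i) ≈ K.0#) → u ≈ᴾ 0#
  Deg<∧roots⇒≈0 zero    r r-inj u deg root i = deg i z≤n
  Deg<∧roots⇒≈0 (suc m) r r-inj u deg root = u≈0 u (root zero) tail≈0
    where
    open SetoidReasoning K.setoid
    r₀ = r zero
    s = syntheticQuotient r₀ u
    s-root : ∀ i → eval s (r (suc i)) ≈ K.0#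
    s-root i = x*y≈0⇒y≈0
      (λ eq → suc≢zero (r-inj (x∙y⁻¹≈ε⇒x≈y (r (suc i)) r₀ eq)))
      (begin
        (x K.- r₀) K.* S            ≈⟨ [y-z]x≈yx-zx S x r₀ ⟩
        x K.* S K.- r₀ K.* S        ≈⟨ K.+-congʳ (K.trans (K.sym (K.+-identityˡ _)) (K.+-congʳ (K.sym (root zero)))) ⟩
        (eval u r₀ K.+ x K.* S) K.- r₀ K.* S     ≈⟨ K.+-congʳ (eval-quotient r₀ u x) ⟨
        (eval u x K.+ r₀ K.* S) K.- r₀ K.* S     ≈⟨ K.+-congʳ (K.trans (K.+-congʳ (root (suc i))) (K.+-identityˡ _)) ⟩
        r₀ K.* S K.- r₀ K.* S       ≈⟨ K.-‿inverseʳ _ ⟩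
        K.0#                        ∎)
      where
      x = r (suc i)
      S = eval s x
      suc≢zero : suc i ≢ zero
      suc≢zero ()
    s≈0 : s ≈ᴾ 0#
    s≈0 = Deg<∧roots⇒≈0 m (r ∘ suc) (Fin.suc-injective ∘ r-inj) s (Deg<-quotient r₀ u deg) s-root
    tail≈0 : ∀ i → coeff u (suc i) ≈ K.0#
    tail≈0 i = begin
      coeff u (suc i)                                   ≈⟨ K.+-identityʳ _ ⟨
      coeff u (suc i) K.+ K.0#                          ≈⟨ K.+-congˡ (K.trans (K.*-congˡ (s≈0 (suc i))) (K.zeroʳ r₀)) ⟨
      coeff u (suc i) K.+ r₀ K.* coeff s (suc i)        ≈⟨ coeff-quotient r₀ u i ⟩
      coeff s i                                         ≈⟨ s≈0 i ⟩
      K.0#                                              ∎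
    u≈0 : ∀ u → eval u r₀ ≈ K.0# → (∀ i → coeff u (suc i) ≈ K.0#) → u ≈ᴾ 0#
    u≈0 []      _  _  i       = K.refl
    u≈0 (a ∷ u) eq tl (suc i) = tl i
    u≈0 (a ∷ u) eq tl zero    = begin
      a                       ≈⟨ K.+-identityʳ a ⟨
      a K.+ K.0#              ≈⟨ K.+-congˡ (K.trans (K.*-congˡ (eval-null u r₀ tl)) (K.zeroʳ r₀)) ⟨
      a K.+ r₀ K.* eval u r₀  ≈⟨ eq ⟩
      K.0#                    ∎

-- The q-th power map and linearized polynomials on K

1<primePower : ∀ {q} → IsPrimePower q → 1 ℕ.< q
1<primePower (p , suc e , pr , _ , ≡.refl) =
  ℕ.≤-trans (ℕ.nonTrivial⇒n>1 p {{prime⇒nonTrivial pr}})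
            (ℕ.m≤m*n p (p ℕ.^ e) {{ℕ.m^n≢0 p e {{prime⇒nonZero pr}}}})

-- For q = p^e the field has (p^e)^n = p^(e n) elements, hence characteristic p, and the q-th power
-- is the e-fold iterate of the p-th.
^primePower-homo-+ : ∀ {c ℓ} q n → IsPrimePower q → (𝔽 : FiniteField c ℓ (q ℕ.^ n)) →
  let open FiniteField 𝔽
      open Exp commutativeSemiring
  in ∀ x y → (x + y) ^ q ≈ x ^ q + y ^ q
^primePower-homo-+ _ n (p , e , pr , _ , ≡.refl) 𝔽 = ^prime^-homo-+ (FiniteField.commutativeRing 𝔽) pr
  (FiniteFieldProperties.characteristic 𝔽 p (e ℕ.* n) (ℕ.^-*-assoc p e n)) e

module Linearized {c₁ ℓ₁ c₂ ℓ₂} (q n : ℕ) (q-primePower : IsPrimePower q)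
  (𝔽q : FiniteField c₁ ℓ₁ q) (𝔽qⁿ : FiniteField c₂ ℓ₂ (q ℕ.^ n))
  (ι : FiniteField.Carrier 𝔽q → FiniteField.Carrier 𝔽qⁿ)
  (ι-mono : RingMorphisms.IsRingMonomorphism (FiniteField.rawRing 𝔽q) (FiniteField.rawRing 𝔽qⁿ) ι)
  where
  module F = FiniteField 𝔽q
  module K = FiniteField 𝔽qⁿ
  private
    module ι = RingMorphisms.IsRingMonomorphism ι-mono
    module FF = FiniteFieldProperties 𝔽q
    module KF = FiniteFieldProperties 𝔽qⁿ
    module K[X] = Polynomial K.rawRing
    module K[X]ₚ = PolynomialRing K.commutativeRing
    module K[X]ᵈ = PolynomialDivision K.commutativeRing
  open K using (_≈_; _≉_)
  open Polynomial F.rawRing hiding (eval)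
  open PolynomialRing F.commutativeRing
  open PolynomialDivision F.commutativeRing
  open Exp K.commutativeSemiring using ()
    renaming (_^_ to _^ᴷ_; ^-congˡ to ^ᴷ-congˡ; ^-assocʳ to ^ᴷ-assocʳ; ^-distrib-* to ^ᴷ-distrib-*)
  open Exp F.commutativeSemiring using () renaming (_^_ to _^ꟳ_)
  open Sum K.semiring using () renaming (sum to sumᴷ; sum-cong-≋ to sumᴷ-cong)
  open RingProperties K.ring using (+-identityˡ-unique; x+x≈x⇒x≈0; x∙y⁻¹≈ε⇒x≈y)
  open CommutativeSemigroupProperties K.+-commutativeSemigroup using (interchange)
  open SetoidReasoning K.setoid

  frobenius-+ : ∀ x y → (x K.+ y) ^ᴷ q ≈ x ^ᴷ q K.+ y ^ᴷ q
  frobenius-+ = ^primePower-homo-+ q n q-primePower 𝔽qⁿ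

  ι-^ : ∀ a m → ι (a ^ꟳ m) ≈ ι a ^ᴷ m
  ι-^ a zero    = ι.1#-homo
  ι-^ a (suc m) = K.trans (ι.*-homo a (a ^ꟳ m)) (K.*-congˡ (ι-^ a m))

  -- The identity a^q = a of 𝔽q carried into K. Both the 𝔽q-linearity of L_u and the composition
  -- rule rest on it.
  ι-frobenius : ∀ a → ι a ^ᴷ q ≈ ι a
  ι-frobenius a = K.trans (K.sym (ι-^ a q)) (ι.⟦⟧-cong (FF.x^N≈x a))

  1<q : 1 ℕ.< q
  1<q = 1<primePower q-primePower

  -- x ↦ L_u(x), by Horner's rule with the Frobenius map in place of multiplication by x.
  Lin : Poly → K.Carrier → K.Carrier
  Lin []      x = K.0#
  Lin (a ∷ u) x = ι a K.* x K.+ Lin u (x ^ᴷ q)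

  Lin-cong : ∀ u {x y} → x ≈ y → Lin u x ≈ Lin u y
  Lin-cong []      x≈y = K.refl
  Lin-cong (a ∷ u) x≈y = K.+-cong (K.*-congˡ x≈y) (Lin-cong u (^ᴷ-congˡ q x≈y))

  -- Links the associate to `Lin`, whose recursion on the coefficients of u supports all later
  -- inductions.
  eval-associate : ∀ u x → K[X].eval (map ι (associate q u)) x ≈ Lin u x
  eval-associate u x = K.trans (ev-sum ι hom (λ i → C (lookup u i) * X ^ (q ℕ.^ toℕ i)) x)
    (K.trans (sumᴷ-cong monomial) (horner u x))
    where
    open EvaluationVia F.commutativeRing K.commutativeRing
    hom = ι.isRingHomomorphism
    monomial : ∀ i → ev ι hom (C (lookup u i) * X ^ (q ℕ.^ toℕ i)) x ≈ ι (lookup u i) K.* x ^ᴷ (q ℕ.^ toℕ i)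
    monomial i = K.trans (ev-* ι hom (C (lookup u i)) (X ^ (q ℕ.^ toℕ i)) x)
                   (K.*-cong (ev-C ι hom (lookup u i) x) (ev-X^ ι hom (q ℕ.^ toℕ i) x))
    horner : ∀ u x → sumᴷ (λ i → ι (lookup u i) K.* x ^ᴷ (q ℕ.^ toℕ i)) ≈ Lin u x
    horner []      x = K.refl
    horner (a ∷ u) x = K.+-cong (K.*-congˡ (K.*-identityʳ x)) ((begin
      sumᴷ (λ i → ι (lookup u i) K.* x ^ᴷ (q ℕ.^ suc (toℕ i)))
        ≈⟨ sumᴷ-cong (λ i → K.*-congˡ {ι (lookup u i)} (^ᴷ-assocʳ x q (q ℕ.^ toℕ i))) ⟨
      sumᴷ (λ i → ι (lookup u i) K.* (x ^ᴷ q) ^ᴷ (q ℕ.^ toℕ i))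
        ≈⟨ horner u (x ^ᴷ q) ⟩
      Lin u (x ^ᴷ q)
        ∎))

  Lin-homo-+ : ∀ u x y → Lin u (x K.+ y) ≈ Lin u x K.+ Lin u y
  Lin-homo-+ []      x y = K.sym (K.+-identityʳ K.0#)
  Lin-homo-+ (a ∷ u) x y = begin
    ι a K.* (x K.+ y) K.+ Lin u ((x K.+ y) ^ᴷ q)
      ≈⟨ K.+-cong (K.distribˡ _ x y) (K.trans (Lin-cong u (frobenius-+ x y)) (Lin-homo-+ u _ _)) ⟩
    (ι a K.* x K.+ ι a K.* y) K.+ (Lin u (x ^ᴷ q) K.+ Lin u (y ^ᴷ q))
      ≈⟨ interchange _ _ _ _ ⟩
    Lin (a ∷ u) x K.+ Lin (a ∷ u) y ∎

  Lin-homo-0 : ∀ u → Lin u K.0# ≈ K.0#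
  Lin-homo-0 u = x+x≈x⇒x≈0 _ (K.trans (K.sym (Lin-homo-+ u K.0# K.0#)) (Lin-cong u (K.+-identityʳ K.0#)))

  Lin-homo-ι* : ∀ u a x → Lin u (ι a K.* x) ≈ ι a K.* Lin u x
  Lin-homo-ι* []      a x = K.sym (K.zeroʳ _)
  Lin-homo-ι* (b ∷ u) a x = begin
    ι b K.* (ι a K.* x) K.+ Lin u ((ι a K.* x) ^ᴷ q)
      ≈⟨ K.+-cong (x∙yz≈y∙xz (ι b) (ι a) x)
           (K.trans (Lin-cong u (K.trans (^ᴷ-distrib-* (ι a) x q) (K.*-congʳ (ι-frobenius a))))
                    (Lin-homo-ι* u a (x ^ᴷ q))) ⟩
    ι a K.* (ι b K.* x) K.+ ι a K.* Lin u (x ^ᴷ q)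
      ≈⟨ K.distribˡ _ _ _ ⟨
    ι a K.* Lin (b ∷ u) x ∎
    where open CommutativeSemigroupProperties K.*-commutativeSemigroup using (x∙yz≈y∙xz)

  -- The q-th power is a ring homomorphism fixing the coefficients of L_u, which lie in 𝔽q.
  Lin-frobenius : ∀ u x → Lin u (x ^ᴷ q) ≈ Lin u x ^ᴷ q
  -- That 0^q = 0 is `ι-frobenius` at 0, so no case distinction on q is made.
  Lin-frobenius []      x = K.sym (K.trans (^ᴷ-congˡ q (K.sym ι.0#-homo)) (K.trans (ι-frobenius F.0#) ι.0#-homo))
  Lin-frobenius (a ∷ u) x = begin
    ι a K.* x ^ᴷ q K.+ Lin u ((x ^ᴷ q) ^ᴷ q)
      ≈⟨ K.+-cong (K.*-congʳ (K.sym (ι-frobenius a))) (Lin-frobenius u (x ^ᴷ q)) ⟩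
    ι a ^ᴷ q K.* x ^ᴷ q K.+ Lin u (x ^ᴷ q) ^ᴷ q
      ≈⟨ K.+-congʳ (^ᴷ-distrib-* (ι a) x q) ⟨
    (ι a K.* x) ^ᴷ q K.+ Lin u (x ^ᴷ q) ^ᴷ q
      ≈⟨ frobenius-+ _ _ ⟨
    Lin (a ∷ u) x ^ᴷ q ∎

  ι0*x≈0 : ∀ x → ι F.0# K.* x ≈ K.0#
  ι0*x≈0 x = K.trans (K.*-congʳ ι.0#-homo) (K.zeroˡ x)

  Lin-null : ∀ u → u ≋ 0# → ∀ x → Lin u x ≈ K.0#
  Lin-null []    e x = K.refl
  Lin-null (a ∷ u) e x = K.trans
    (K.+-cong (K.trans (K.*-congʳ (ι.⟦⟧-cong (e .at 0))) (ι0*x≈0 x)) (Lin-null u (coeffwise (e .at ∘ suc)) _))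
    (K.+-identityʳ K.0#)

  Lin-≋ : ∀ {u v} → u ≋ v → ∀ x → Lin u x ≈ Lin v x
  Lin-≋ {[]}    {v}     e x = K.sym (Lin-null v (coeffwise (F.sym ∘ e .at)) x)
  Lin-≋ {a ∷ u} {[]}    e x = Lin-null (a ∷ u) e x
  Lin-≋ {a ∷ u} {b ∷ v} e x =
    K.+-cong (K.*-congʳ (ι.⟦⟧-cong (e .at 0))) (Lin-≋ {u} {v} (coeffwise (e .at ∘ suc)) _)

  Lin-+ : ∀ u v x → Lin (u + v) x ≈ Lin u x K.+ Lin v x
  Lin-+ []      v       x = K.sym (K.+-identityˡ _)
  Lin-+ (a ∷ u) []      x = K.sym (K.+-identityʳ _)
  Lin-+ (a ∷ u) (b ∷ v) x = begin
    ι (a F.+ b) K.* x K.+ Lin (u + v) (x ^ᴷ q)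
      ≈⟨ K.+-cong (K.trans (K.*-congʳ (ι.+-homo a b)) (K.distribʳ x _ _)) (Lin-+ u v _) ⟩
    (ι a K.* x K.+ ι b K.* x) K.+ (Lin u (x ^ᴷ q) K.+ Lin v (x ^ᴷ q))
      ≈⟨ interchange _ _ _ _ ⟩
    Lin (a ∷ u) x K.+ Lin (b ∷ v) x ∎

  Lin-scale : ∀ a u x → Lin (scale a u) x ≈ ι a K.* Lin u x
  Lin-scale a []      x = K.sym (K.zeroʳ _)
  Lin-scale a (b ∷ u) x = begin
    ι (a F.* b) K.* x K.+ Lin (scale a u) (x ^ᴷ q)
      ≈⟨ K.+-cong (K.trans (K.*-congʳ (ι.*-homo a b)) (K.*-assoc _ _ x)) (Lin-scale a u _) ⟩
    ι a K.* (ι b K.* x) K.+ ι a K.* Lin u (x ^ᴷ q)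
      ≈⟨ K.distribˡ _ _ _ ⟨
    ι a K.* Lin (b ∷ u) x ∎

  Lin-shift : ∀ u x → Lin (shift u) x ≈ Lin u (x ^ᴷ q)
  Lin-shift u x = K.trans (K.+-congʳ (ι0*x≈0 x)) (K.+-identityˡ _)

  -- Multiplying by x precomposes with the q-th power, which `Lin-frobenius` then moves outside L_v.
  Lin-* : ∀ u v x → Lin (u * v) x ≈ Lin u (Lin v x)
  Lin-* []      v x = K.refl
  Lin-* (a ∷ u) v x = begin
    Lin (scale a v + shift (u * v)) x              ≈⟨ Lin-+ (scale a v) (shift (u * v)) x ⟩
    Lin (scale a v) x K.+ Lin (shift (u * v)) x    ≈⟨ K.+-cong (Lin-scale a v x) (Lin-shift (u * v) x) ⟩
    ι a K.* Lin v x K.+ Lin (u * v) (x ^ᴷ q)       ≈⟨ K.+-congˡ (Lin-* u v _) ⟩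
    ι a K.* Lin v x K.+ Lin u (Lin v (x ^ᴷ q))     ≈⟨ K.+-congˡ (Lin-cong u (Lin-frobenius v x)) ⟩
    ι a K.* Lin v x K.+ Lin u (Lin v x ^ᴷ q)       ∎

  Lin-comm : ∀ u v x → Lin u (Lin v x) ≈ Lin v (Lin u x)
  Lin-comm u v x = K.trans (K.sym (Lin-* u v x)) (K.trans (Lin-≋ (*-comm u v) x) (Lin-* v u x))

  Lin-∣ : ∀ {u v} → u ∣ v → ∀ {x} → Lin u x ≈ K.0# → Lin v x ≈ K.0#
  Lin-∣ {u} {v} (w , wu≈v) {x} Lux≈0 = begin
    Lin v x           ≈⟨ Lin-≋ {w * u} {v} (coeffwise wu≈v) x ⟨
    Lin (w * u) x     ≈⟨ Lin-* w u x ⟩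
    Lin w (Lin u x)   ≈⟨ Lin-cong w Lux≈0 ⟩
    Lin w K.0#        ≈⟨ Lin-homo-0 w ⟩
    K.0#              ∎

  Lin-1 : ∀ x → Lin 1# x ≈ x
  Lin-1 x = K.trans (K.+-identityʳ _) (K.trans (K.*-congʳ ι.1#-homo) (K.*-identityˡ x))

  Lin-X^ : ∀ m x → Lin (X ^ m) x ≈ x ^ᴷ (q ℕ.^ m)
  Lin-X^ zero    x = K.trans (Lin-1 x) (K.sym (K.*-identityʳ x))
  Lin-X^ (suc m) x = begin
    Lin (X * X ^ m) x         ≈⟨ Lin-≋ (X*≋shift (X ^ m)) x ⟩
    Lin (shift (X ^ m)) x     ≈⟨ Lin-shift (X ^ m) x ⟩
    Lin (X ^ m) (x ^ᴷ q)      ≈⟨ Lin-X^ m _ ⟩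
    (x ^ᴷ q) ^ᴷ (q ℕ.^ m)     ≈⟨ ^ᴷ-assocʳ x q (q ℕ.^ m) ⟩
    x ^ᴷ (q ℕ.^ suc m)        ∎

  -- The associate of xⁿ - 1 is x^(qⁿ) - x, and K has qⁿ elements.
  Lin-X^n-1 : ∀ x → Lin (X^n-1 n) x ≈ K.0#
  Lin-X^n-1 x = +-identityˡ-unique (Lin (X^n-1 n) x) x (begin
    Lin (X^n-1 n) x K.+ x            ≈⟨ K.+-congˡ (Lin-1 x) ⟨
    Lin (X^n-1 n) x K.+ Lin 1# x     ≈⟨ Lin-+ (X^n-1 n) 1# x ⟨
    Lin ((X ^ n + - 1#) + 1#) x      ≈⟨ Lin-≋ (+-assoc (X ^ n) (- 1#) 1#) x ⟩
    Lin (X ^ n + (- 1# + 1#)) x      ≈⟨ Lin-≋ (+-congˡ {X ^ n} (coeffwise λ where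
                                          zero    → F.-‿inverseˡ F.1#
                                          (suc i) → F.refl)) x ⟩
    Lin (X ^ n + 0#) x               ≈⟨ Lin-≋ (+-identityʳ (X ^ n)) x ⟩
    Lin (X ^ n) x                    ≈⟨ Lin-X^ n x ⟩
    x ^ᴷ (q ℕ.^ n)                   ≈⟨ KF.x^N≈x x ⟩
    x                                ∎)

  Lin-difference : ∀ u {x y} → Lin u x ≈ Lin u y → Lin u (x K.- y) ≈ K.0#
  Lin-difference u {x} {y} e = +-identityˡ-unique _ (Lin u y) (begin
    Lin u (x K.- y) K.+ Lin u y   ≈⟨ Lin-homo-+ u (x K.- y) y ⟨
    Lin u ((x K.- y) K.+ y)       ≈⟨ Lin-cong u (K.trans (K.+-assoc _ _ _)
                                       (K.trans (K.+-congˡ (K.-‿inverseˡ y)) (K.+-identityʳ x))) ⟩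
    Lin u x                       ≈⟨ e ⟩
    Lin u y                       ∎)

  -- Linear independence of the maps x ↦ x^(q^i) for i < n

  -- `Lin` splits off the lowest term; here the highest one is split off, because the degree
  -- argument removes terms from the top.
  partialSum : (ℕ → K.Carrier) → ℕ → K.Carrier → K.Carrier
  partialSum a zero    x = K.0#
  partialSum a (suc m) x = partialSum a m x K.+ a m K.* x ^ᴷ (q ℕ.^ m)

  partialSum-head : ∀ a m x → partialSum a (suc m) x ≈ a 0 K.* x K.+ partialSum (a ∘ suc) m (x ^ᴷ q)
  partialSum-head a zero    x = K.trans (K.+-comm _ _) (K.+-congʳ (K.*-congˡ (K.*-identityʳ x)))
  partialSum-head a (suc m) x = begin
    partialSum a (suc m) x K.+ a (suc m) K.* x ^ᴷ (q ℕ.^ suc m)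
      ≈⟨ K.+-cong (partialSum-head a m x) (K.*-congˡ (K.sym (^ᴷ-assocʳ x q (q ℕ.^ m)))) ⟩
    (a 0 K.* x K.+ partialSum (a ∘ suc) m (x ^ᴷ q)) K.+ a (suc m) K.* (x ^ᴷ q) ^ᴷ (q ℕ.^ m)
      ≈⟨ K.+-assoc _ _ _ ⟩
    a 0 K.* x K.+ partialSum (a ∘ suc) (suc m) (x ^ᴷ q)
      ∎

  Lin≈partialSum : ∀ m u → Deg< m u → ∀ x → Lin u x ≈ partialSum (ι ∘ coeff u) m x
  Lin≈partialSum zero    u       deg x = Lin-null u (coeffwise λ i → deg i z≤n) x
  Lin≈partialSum (suc m) []      deg x = K.sym (zeros (suc m))
    where
    zeros : ∀ m → partialSum (λ _ → ι F.0#) m x ≈ K.0#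
    zeros zero    = K.refl
    zeros (suc m) = K.trans (K.+-cong (zeros m) (ι0*x≈0 _)) (K.+-identityʳ _)
  Lin≈partialSum (suc m) (a ∷ u) deg x = K.trans
    (K.+-congˡ (Lin≈partialSum m u (λ i m≤i → deg (suc i) (s≤s m≤i)) _))
    (K.sym (partialSum-head (ι ∘ coeff (a ∷ u)) m x))

  X^q^_ : ℕ → K[X].Poly
  X^q^ m = K[X].X K[X].^ (q ℕ.^ m)

  partialSumPoly : (ℕ → K.Carrier) → ℕ → K[X].Poly
  partialSumPoly a zero    = K[X].0#
  partialSumPoly a (suc m) = partialSumPoly a m K[X].+ K[X]ₚ.scale (a m) (X^q^ m)

  eval-partialSumPoly : ∀ a m x → K[X].eval (partialSumPoly a m) x ≈ partialSum a m x
  eval-partialSumPoly a zero    x = K.refl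
  eval-partialSumPoly a (suc m) x = K.trans (eval-+ (partialSumPoly a m) _ x)
    (K.+-cong (eval-partialSumPoly a m x)
              (K.trans (eval-scale (a m) (X^q^ m) x) (K.*-congˡ (eval-X^ (q ℕ.^ m) x))))
    where open Evaluation K.commutativeRing

  q^m<q^1+m : ∀ m → q ℕ.^ m ℕ.< q ℕ.^ suc m
  q^m<q^1+m m = ℕ.^-monoʳ-< q 1<q (ℕ.n<1+n m)

  -- The bound q^m is the exponent of the next monomial, so that monomial alone decides the
  -- coefficient there; for m = n it is also the number of elements of K.
  Deg<-partialSumPoly : ∀ a m → K[X]ᵈ.Deg< (q ℕ.^ m) (partialSumPoly a m)
  Deg<-partialSumPoly a zero    i _ = K.refl
  Deg<-partialSumPoly a (suc m) i q^1+m≤i = begin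
    K[X].coeff (partialSumPoly a (suc m)) i
      ≈⟨ K[X]ₚ.coeff-+ (partialSumPoly a m) _ i ⟩
    K[X].coeff (partialSumPoly a m) i K.+ K[X].coeff (K[X]ₚ.scale (a m) (X^q^ m)) i
      ≈⟨ K.+-cong (Deg<-partialSumPoly a m i (ℕ.<⇒≤ q^m<i)) (K[X]ₚ.coeff-scale (a m) (X^q^ m) i) ⟩
    K.0# K.+ a m K.* K[X].coeff (X^q^ m) i
      ≈⟨ K.+-identityˡ _ ⟩
    a m K.* K[X].coeff (X^q^ m) i
      ≈⟨ K.*-congˡ (K[X]ᵈ.Deg<-X^ (q ℕ.^ m) i q^m<i) ⟩
    a m K.* K.0#
      ≈⟨ K.zeroʳ _ ⟩
    K.0# ∎
    where
    q^m<i : q ℕ.^ m ℕ.< i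
    q^m<i = ℕ.<-≤-trans (q^m<q^1+m m) q^1+m≤i

  coeff-partialSumPoly-top : ∀ a m → K[X].coeff (partialSumPoly a (suc m)) (q ℕ.^ m) ≈ a m
  coeff-partialSumPoly-top a m = begin
    K[X].coeff (partialSumPoly a (suc m)) (q ℕ.^ m)
      ≈⟨ K[X]ₚ.coeff-+ (partialSumPoly a m) _ (q ℕ.^ m) ⟩
    K[X].coeff (partialSumPoly a m) (q ℕ.^ m) K.+ K[X].coeff (K[X]ₚ.scale (a m) (X^q^ m)) (q ℕ.^ m)
      ≈⟨ K.+-cong (Deg<-partialSumPoly a m (q ℕ.^ m) ℕ.≤-refl) (K[X]ₚ.coeff-scale (a m) (X^q^ m) (q ℕ.^ m)) ⟩
    K.0# K.+ a m K.* K[X].coeff (X^q^ m) (q ℕ.^ m)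
      ≈⟨ K.+-identityˡ _ ⟩
    a m K.* K[X].coeff (X^q^ m) (q ℕ.^ m)
      ≈⟨ K.*-congˡ (K[X]ᵈ.coeff-X^-top (q ℕ.^ m)) ⟩
    a m K.* K.1#
      ≈⟨ K.*-identityʳ _ ⟩
    a m ∎

  -- A nonzero partial sum of degree below qⁿ cannot have all qⁿ elements of K as roots.
  partialSum-top≈0 : ∀ a m → m ℕ.< n → (∀ x → partialSum a (suc m) x ≈ K.0#) → a m ≈ K.0#
  partialSum-top≈0 a m m<n vanish =
    K.trans (K.sym (coeff-partialSumPoly-top a m)) (Roots.Deg<∧roots⇒≈0 𝔽qⁿ (q ℕ.^ n)
      KF.element KF.element-injective (partialSumPoly a (suc m))
      (λ i q^n≤i → Deg<-partialSumPoly a (suc m) i (ℕ.≤-trans q^1+m≤q^n q^n≤i))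
      (λ i → K.trans (eval-partialSumPoly a (suc m) (KF.element i)) (vanish _)) (q ℕ.^ m))
    where
    q^1+m≤q^n : q ℕ.^ suc m ℕ.≤ q ℕ.^ n
    q^1+m≤q^n = ℕ.^-monoʳ-≤ q {{ℕ.>-nonZero (ℕ.<-trans z<s 1<q)}} m<n

  -- The top coefficient vanishes by the root count; its term then drops out and the shorter sum
  -- vanishes as well.
  partialSum-independent : ∀ a m → m ℕ.≤ n → (∀ x → partialSum a m x ≈ K.0#) →
                           ∀ i → i ℕ.< m → a i ≈ K.0#
  partialSum-independent a (suc m) m<n vanish i i<1+m with ℕ.m≤n⇒m<n∨m≡n (ℕ.s≤s⁻¹ i<1+m)
  ... | inj₁ i<m    = partialSum-independent a m (ℕ.<⇒≤ m<n) vanish′ i i<m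
    where
    top≈0 : a m ≈ K.0#
    top≈0 = partialSum-top≈0 a m m<n vanish
    vanish′ : ∀ x → partialSum a m x ≈ K.0#
    vanish′ x = begin
      partialSum a m x                                   ≈⟨ K.+-identityʳ _ ⟨
      partialSum a m x K.+ K.0#                          ≈⟨ K.+-congˡ (K.trans (K.*-congʳ top≈0) (K.zeroˡ _)) ⟨
      partialSum a m x K.+ a m K.* x ^ᴷ (q ℕ.^ m)        ≈⟨ vanish x ⟩
      K.0#                                               ∎
  ... | inj₂ ≡.refl = partialSum-top≈0 a m m<n vanish

  -- The bound n is sharp: xⁿ - 1 has an associate vanishing on K. The coefficients are shown to be
  -- 0 in K and pulled back by injectivity of ι.
  Lin≈0⇒≈0 : ∀ u → Deg< n u → (∀ x → Lin u x ≈ K.0#) → u ≋ 0#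
  Lin≈0⇒≈0 u deg vanish .at i with ℕ.<-≤-connex i n
  ... | inj₁ i<n = ι.injective (K.trans
    (partialSum-independent (ι ∘ coeff u) n ℕ.≤-refl
      (λ x → K.trans (K.sym (Lin≈partialSum n u deg x)) (vanish x)) i i<n)
    (K.sym ι.0#-homo))
  ... | inj₂ n≤i = deg i n≤i

  -- Coprimality of g and h against the kernels of L_g and L_h

  KernelsDisjoint : Poly → Poly → Set _
  KernelsDisjoint g h = ∀ {x} → Lin g x ≈ K.0# → Lin h x ≈ K.0# → x ≈ K.0#

  F-inverse : ∀ a → a F.≉ F.0# → ∃[ b ] a F.* b F.≈ F.1#
  F-inverse a a≉0 with F.invertible a a≉0
  ... | b , _ , ab≈1 = b , ab≈1

  coprime⇒kernelsDisjoint : ∀ {g h} → (∀ {w} → w ∣ g → w ∣ h → w ∣ 1#) → KernelsDisjoint g h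
  coprime⇒kernelsDisjoint {g} {h} coprime {x} gx≈0 hx≈0 =
    -- For fixed x the polynomials u with L_u(x) = 0 form an ideal; membership of D in it takes the
    -- place of Bézout coefficients.
    let D , D∣g , D∣h , Dx≈0 = euclid FF._≟_ F-inverse (λ u → Lin u x ≈ K.0#) remainder
                                 (length h) g h (Deg<-length h)
    in K.trans (K.sym (Lin-1 x)) (Lin-∣ (coprime D∣g D∣h) (Dx≈0 gx≈0 hx≈0))
    where
    remainder : ∀ {g h r} t → g ≋ t * h + r → Lin g x ≈ K.0# → Lin h x ≈ K.0# → Lin r x ≈ K.0#
    remainder {g} {h} {r} t g≋ gx≈0 hx≈0 = begin
      Lin r x                      ≈⟨ K.+-identityˡ _ ⟨
      K.0# K.+ Lin r x             ≈⟨ K.+-congʳ (Lin-∣ {h} {t * h} (t , λ i → F.refl) hx≈0) ⟨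
      Lin (t * h) x K.+ Lin r x    ≈⟨ Lin-+ (t * h) r x ⟨
      Lin (t * h + r) x            ≈⟨ Lin-≋ g≋ x ⟨
      Lin g x                      ≈⟨ gx≈0 ⟩
      K.0#                         ∎

  injective⇒∣1 : .{{_ : NonZero n}} → ∀ {w} → w ∣ X^n-1 n → (∀ {x} → Lin w x ≈ K.0# → x ≈ K.0#) → w ∣ 1#
  injective⇒∣1 {w} (v , vw≈) ker-w with divide (Deg<-X^n-1 n) (coeff-X^n-1-top n) v
  ... | t , r , v≋ , deg-r =
    ∣cofactor⇒∣1 (coeff-X^n-1-const n) {v} {w} {t} (coeffwise vw≈)
      (F[X].trans v≋ (F[X].trans (+-congˡ {t * m} (Lin≈0⇒≈0 r deg-r Lin-r≈0)) (+-identityʳ (t * m))))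
    where
    module F[X] = CommutativeRing polynomialRing
    m : Poly
    m = X^n-1 n
    onto : ∀ y → ∃[ x ] Lin w x ≈ y
    onto = KF.injective⇒surjective (Lin w)
      (λ {x} {y} e → x∙y⁻¹≈ε⇒x≈y x y (ker-w (Lin-difference w e)))
    Lin-v≈0 : ∀ y → Lin v y ≈ K.0#
    Lin-v≈0 y with onto y
    ... | x , wx≈y = begin
      Lin v y           ≈⟨ Lin-cong v wx≈y ⟨
      Lin v (Lin w x)   ≈⟨ Lin-* v w x ⟨
      Lin (v * w) x     ≈⟨ Lin-≋ {v * w} {m} (coeffwise vw≈) x ⟩
      Lin m x           ≈⟨ Lin-X^n-1 x ⟩
      K.0#              ∎
    Lin-r≈0 : ∀ x → Lin r x ≈ K.0#
    Lin-r≈0 x = begin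
      Lin r x                      ≈⟨ K.+-identityˡ _ ⟨
      K.0# K.+ Lin r x             ≈⟨ K.+-congʳ (Lin-∣ {m} {t * m} (t , λ i → F.refl) (Lin-X^n-1 x)) ⟨
      Lin (t * m) x K.+ Lin r x    ≈⟨ Lin-+ (t * m) r x ⟨
      Lin (t * m + r) x            ≈⟨ Lin-≋ v≋ x ⟨
      Lin v x                      ≈⟨ Lin-v≈0 x ⟩
      K.0#                         ∎

  -- A zero of L_w is a common zero of L_g and L_h, so L_w has trivial kernel.
  kernelsDisjoint⇒coprime : .{{_ : NonZero n}} → ∀ {g h} → g ∣ X^n-1 n → KernelsDisjoint g h →
                            ∀ {w} → w ∣ g → w ∣ h → w ∣ 1#
  kernelsDisjoint⇒coprime g∣X^n-1 disjoint w∣g w∣h = injective⇒∣1 (∣-trans w∣g g∣X^n-1)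
    (λ wx≈0 → disjoint (Lin-∣ w∣g wx≈0) (Lin-∣ w∣h wx≈0))

  -- The permutation criterion for P

  module PermutationCriterion .{{_ : NonZero n}} (g h : Poly) (f k : K[X].Poly) where
    L : Poly → K[X].Poly
    L u = map ι (associate q u)

    P Q : K[X].Poly
    P = f K[X].∘ᴾ L g K[X].+ (k K[X].∘ᴾ L g) K[X].* L h
    Q = L g K[X].∘ᴾ f K[X].+ k K[X].* L h

    S : Pred K.Carrier _
    S = K[X].valueSet (L g)

    open Evaluation K.commutativeRing
    open K[X] using (eval)
    private
      G H : K.Carrier → K.Carrier
      G = Lin g
      H = Lin h

    eval-P : ∀ x → eval P x ≈ eval f (G x) K.+ eval k (G x) K.* H x
    eval-P x = K.trans (eval-+ (f K[X].∘ᴾ L g) _ x) (K.+-cong (at-G f)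
      (K.trans (eval-* (k K[X].∘ᴾ L g) (L h) x) (K.*-cong (at-G k) (eval-associate h x))))
      where
      at-G : ∀ u → eval (u K[X].∘ᴾ L g) x ≈ eval u (G x)
      at-G u = K.trans (eval-∘ u (L g) x) (eval-cong u (eval-associate g x))

    eval-Q : ∀ y → eval Q y ≈ G (eval f y) K.+ eval k y K.* H y
    eval-Q y = K.trans (eval-+ (L g K[X].∘ᴾ f) _ y) (K.+-cong
      (K.trans (eval-∘ (L g) f y) (eval-associate g (eval f y)))
      (K.trans (eval-* k (L h) y) (K.*-congˡ (eval-associate h y))))

    G∈S : ∀ x → G x ∈ S
    G∈S x = x , eval-associate g x

    S-resp : ∀ {x y} → x ≈ y → x ∈ S → y ∈ S
    S-resp x≈y (z , Gz≈x) = z , K.trans Gz≈x x≈y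

    -- A search through the finite field K; the decision is what allows Q to be extended by the
    -- identity outside `S`.
    S? : Decidable S
    S? y = KF.any? (λ x≈x′ Gx≈y → K.trans (eval-cong (L g) (K.sym x≈x′)) Gx≈y)
                   (λ x → eval (L g) x KF.≟ y)

    -- P sees x only through the pair (L_g(x), L_h(x)), so P can be injective only if the pair
    -- determines x.
    P-cong : ∀ {x y} → G x ≈ G y → H x ≈ H y → eval P x ≈ eval P y
    P-cong {x} {y} Gx≈Gy Hx≈Hy = K.trans (eval-P x) (K.trans
      (K.+-cong (eval-cong f Gx≈Gy) (K.*-cong (eval-cong k Gx≈Gy) Hx≈Hy)) (K.sym (eval-P y)))

    module _ (k-values : ∀ {y} → y ∈ S → ∃[ a ] (a F.≉ F.0# × ι a ≈ eval k y)) where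

      k≉0 : ∀ x → eval k (G x) ≉ K.0#
      k≉0 x kGx≈0 with k-values (G∈S x)
      ... | a , a≉0 , ιa≈k = a≉0 (ι.injective (K.trans (K.trans ιa≈k kGx≈0) (K.sym ι.0#-homo)))

      G∘P≈Q∘G : ∀ x → G (eval P x) ≈ eval Q (G x)
      G∘P≈Q∘G x with k-values (G∈S x)
      ... | a , _ , ιa≈k = begin
        G (eval P x)                                          ≈⟨ Lin-cong g (eval-P x) ⟩
        G (eval f (G x) K.+ eval k (G x) K.* H x)             ≈⟨ Lin-homo-+ g _ _ ⟩
        -- L_g is linear over 𝔽q only, so the value of k must appear as `ι a` before it can be
        -- pulled out.
        G (eval f (G x)) K.+ G (eval k (G x) K.* H x)         ≈⟨ K.+-congˡ (Lin-cong g (K.*-congʳ ιa≈k)) ⟨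
        G (eval f (G x)) K.+ G (ι a K.* H x)                  ≈⟨ K.+-congˡ (Lin-homo-ι* g a (H x)) ⟩
        G (eval f (G x)) K.+ ι a K.* G (H x)                  ≈⟨ K.+-congˡ (K.*-cong ιa≈k (Lin-comm g h x)) ⟩
        G (eval f (G x)) K.+ eval k (G x) K.* H (G x)         ≈⟨ eval-Q (G x) ⟨
        eval Q (G x)                                          ∎

      Q-closed : ∀ {y} → y ∈ S → eval Q y ∈ S
      Q-closed (x , Lx≈y) = S-resp (K.trans (G∘P≈Q∘G x)
        (eval-cong Q (K.trans (K.sym (eval-associate g x)) Lx≈y))) (G∈S (eval P x))

      -- A common zero x of L_g and L_h has P(x) = P(0).
      permutation⇒kernelsDisjoint : (∀ {x y} → eval P x ≈ eval P y → x ≈ y) → KernelsDisjoint g h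
      permutation⇒kernelsDisjoint P-inj Gx≈0 Hx≈0 =
        P-inj (P-cong (K.trans Gx≈0 (K.sym (Lin-homo-0 g))) (K.trans Hx≈0 (K.sym (Lin-homo-0 h))))

      -- Lift y through L_g to x and x through P to z; then Q(L_g(z)) = L_g(P(z)) = y.
      Q-surjective : (∀ y → ∃[ x ] eval P x ≈ y) → ∀ {y} → y ∈ S → ∃[ x ] x ∈ S × eval Q x ≈ y
      Q-surjective P-sur (x , Lx≈y) with P-sur x
      ... | z , Pz≈x = G z , G∈S z , K.trans (K.sym (G∘P≈Q∘G z))
        (K.trans (Lin-cong g Pz≈x) (K.trans (K.sym (eval-associate g x)) Lx≈y))

      -- Equal values of Q only put two values of P into the same fibre of L_g, so injectivity of P
      -- does not transfer directly; it is recovered from surjectivity on the finite set `S`.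
      permutation⇒inducesPermutation : K[X].IsPermutationPolynomial P → K[X].InducesPermutationOf S Q
      permutation⇒inducesPermutation (P-inj , P-sur) =
        Q-closed ,
        (λ {(x , x∈S)} {(y , y∈S)} → KF.surjective⇒injective-on S? S-resp (eval Q) (eval-cong Q) onto x∈S y∈S) ,
        λ (y , y∈S) → let x , x∈S , Qx≈y = onto y∈S
                      in (x , x∈S) , λ z≈x → K.trans (eval-cong Q z≈x) Qx≈y
        where
        onto : ∀ {y} → y ∈ S → ∃[ x ] x ∈ S × eval Q x ≈ y
        onto = Q-surjective λ y → let x , Px≈y = P-sur y in x , Px≈y K.refl

      P-injective : KernelsDisjoint g h →
                    (∀ {x y} → x ∈ S → y ∈ S → eval Q x ≈ eval Q y → x ≈ y) →
                    ∀ {x y} → eval P x ≈ eval P y → x ≈ y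
      P-injective disjoint Q-inj {x} {y} Px≈Py =
        x∙y⁻¹≈ε⇒x≈y x y (disjoint (Lin-difference g Gx≈Gy) (Lin-difference h Hx≈Hy))
        where
        Gx≈Gy : G x ≈ G y
        Gx≈Gy = Q-inj (G∈S x) (G∈S y)
          (K.trans (K.sym (G∘P≈Q∘G x)) (K.trans (Lin-cong g Px≈Py) (G∘P≈Q∘G y)))
        -- As L_g(x) = L_g(y), the f-terms agree and the k-factors agree; the former cancel, and the
        -- latter do because k is nonzero on `S`.
        Hx≈Hy : H x ≈ H y
        Hx≈Hy = KF.*-cancelˡ-nonZero (k≉0 x) (+-cancelˡ _ _ _ (begin
          eval f (G x) K.+ eval k (G x) K.* H x   ≈⟨ eval-P x ⟨
          eval P x                                ≈⟨ Px≈Py ⟩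
          eval P y                                ≈⟨ eval-P y ⟩
          eval f (G y) K.+ eval k (G y) K.* H y   ≈⟨ K.+-cong (eval-cong f Gx≈Gy) (K.*-congʳ (eval-cong k Gx≈Gy)) ⟨
          eval f (G x) K.+ eval k (G x) K.* H y   ∎))
          where open RingProperties K.ring using (+-cancelˡ)

      criterion : g ∣ X^n-1 n →
                  K[X].IsPermutationPolynomial P ⇔ (IsGCD g h 1# × K[X].InducesPermutationOf S Q)
      criterion g∣X^n-1 = mk⇔
        (λ perm@(P-inj , _) →
          coprime⇒IsGCD-1 (kernelsDisjoint⇒coprime g∣X^n-1 (permutation⇒kernelsDisjoint P-inj)) ,
          permutation⇒inducesPermutation perm)
        (λ (gcd , _ , Q-inj , _) →
          let P-inj = P-injective (coprime⇒kernelsDisjoint (IsGCD.greatest gcd))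
                        (λ x∈S y∈S → Q-inj {_ , x∈S} {_ , y∈S})
          in P-inj , λ y → let x , Px≈y = KF.injective⇒surjective (eval P) P-inj y
                           in x , λ z≈x → K.trans (eval-cong P z≈x) Px≈y)

theorem2p5 :
    ∀ {c₁ ℓ₁ c₂ ℓ₂} (q n : ℕ) → IsPrimePower q → .{{_ : NonZero n}} →
    (𝔽q : FiniteField c₁ ℓ₁ q) (𝔽qⁿ : FiniteField c₂ ℓ₂ (q ℕ.^ n)) →
    let module F = FiniteField 𝔽q
        module K = FiniteField 𝔽qⁿ
        module F[X] = Polynomial F.rawRing
        open Polynomial K.rawRing
    in
    (ι : F.Carrier → K.Carrier) →
    RingMorphisms.IsRingMonomorphism F.rawRing K.rawRing ι →
    (g h : F[X].Poly) (f k : Poly) →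
    let L : F[X].Poly → Poly
        L u = map ι (F[X].associate q u)
    in
    F[X].Monic g →
    g F[X].∣ (F[X].X F[X].^ n F[X].+ F[X].- F[X].1#) →
    (∀ {y} → y ∈ valueSet (L g) → ∃[ a ] (a F.≉ F.0# × ι a K.≈ eval k y)) →
    let P = f ∘ᴾ L g + (k ∘ᴾ L g) * L h
        Q = L g ∘ᴾ f + k * L h
    in
    IsPermutationPolynomial P ⇔
      (F[X].IsGCD g h F[X].1# × InducesPermutationOf (valueSet (L g)) Q)
theorem2p5 q n q-primePower 𝔽q 𝔽qⁿ ι ι-mono g h f k _ g∣X^n-1 k-values =
  Linearized.PermutationCriterion.criterion q n q-primePower 𝔽q 𝔽qⁿ ι ι-mono g h f k k-values g∣X^n-1
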